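{- Let $\pi$ be a simple permutation and let $w$ be a strict pin word corresponding to a permutation $\sigma$. Then $\pi\not\le\sigma$ if and only if $\phi(w)$ has no factor belonging to the finite set $E(\pi)$.
   Context: Permutations of length $n$ are bijections of $\{1,\dots,n\}$, identified with their diagrams $\{(i,\sigma(i))\}$. $\pi\le\sigma$ means some subsequence of $\sigma$ is order isomorphic to $\pi$. A permutation of length $n$ is simple if no set of $l$ consecutive positions ($2\le l\le n-1$) has values forming a set of consecutive integers. Pins are points of $\mathbb{Z}^2$. A pin $p$ separates a set $P$ from a set $Q$ horizontally (resp. vertically) if the horizontal (resp. vertical) line through $p$ has $P$ strictly on one side and $Q$ strictly on the other. A pin sequence is a sequence $(p_1,\dots,p_k)$ of pins, no two in a common row or column, such that for every $i\ge2$, $p_i$ lies outside the bounding box of $\{p_1,\dots,p_{i-1}\}$ and either $p_i$ separates $p_{i-1}$ from $\{p_1,\dots,p_{i-2}\}$, or $p_i$ is independent from $\{p_1,\dots,p_{i-1}\}$ (does not separate it into two nonempty sets). A pin representation of $\sigma$ is a pin sequence order isomorphic to the diagram of $\sigma$. Pin words are words on $\{1,2,3,4,U,D,L,R\}$ obtained as follows: given a pin representation $(p_1,\dots,p_n)$, choose an origin $p_0$ such that $(p_0,p_1,\dots,p_n)$ is a pin sequence, and encode each $p_i$, $i\ge1$, by a letter: $U$ (resp. $D,L,R$) if $p_i$ separates $p_{i-1}$ from $\{p_0,\dots,p_{i-2}\}$ and lies above (resp. below, left of, right of) the bounding box of $\{p_0,\dots,p_{i-1}\}$; $1$ (resp.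 $2,3,4$) if $p_i$ is independent from $\{p_0,\dots,p_{i-1}\}$ and lies in the up-right (resp. up-left, bottom-left, bottom-right) corner region of the bounding box of $\{p_0,\dots,p_{i-1}\}$. Such a word is said to correspond to (encode) the pin representation and the permutation $\sigma$. Letters $1,2,3,4$ are numerals, $U,D,L,R$ directions. A strict pin word is a pin word of length at least $2$ whose first letter is a numeral and all other letters are directions; a quasi-strict pin word is a pin word of length at least $2$ whose first two letters are numerals and all other letters are directions. Let $\mathcal{SP}$ be the set of words consisting of a numeral followed by a nonempty word over $\{L,R,U,D\}$ in which letters of $\{L,R\}$ and $\{U,D\}$ alternate. Let $M$ be the set of words of length at least $3$ over $\{L,R,U,D\}$ in which letters of $\{L,R\}$ and of $\{U,D\}$ alternate. Define $\phi:\mathcal{SP}\to M$ by $\phi(u'u'')=\varphi(u')u''$ for $|u'|=2$, where $\varphi$ is: $1R\mapsto RUR$, $2R\mapsto LUR$, $3R\mapsto LDR$, $4R\mapsto RDR$, $1L\mapsto RUL$, $2L\mapsto LUL$, $3L\mapsto LDL$, $4L\mapsto RDL$, $1U\mapsto URU$, $2U\mapsto ULU$, $3U\mapsto DLU$, $4U\mapsto DRU$, $1D\mapsto URD$, $2D\mapsto ULD$, $3D\mapsto DLD$, $4D\mapsto DRD$. For single numerals set $\phi(1)=\{UR,RU\}$, $\phi(2)=\{UL,LU\}$, $\phi(3)=\{DL,LD\}$, $\phi(4)=\{RD,DR\}$. For a simple permutation $\pi$, $E(\pi)$ is the set of words $\phi(u)$ for $u$ a strict pin word corresponding to $\pi$,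 together with the words $v\in M$ of the form $v=x\,\phi(u_2\cdots u_{|u|})$ where $u=u_1\cdots u_{|u|}$ is a quasi-strict pin word corresponding to $\pi$ and $x\in\{LU,LD,RU,RD,UL,UR,DL,DR\}$. A factor of a word is a contiguous subword.
   Formalization: The simple permutation π is assumed to have length at least 2: for length 1 (or 0), π is contained in every σ while E(π) is empty, since strict and quasi-strict pin words have length at least 2, so the stated equivalence fails there. -}

module Defs where

open import Level using (0ℓ)
open import Data.Fin as Fin using (Fin; suc; toℕ; inject₁)
open import Data.Fin.Permutation using (Permutation; Permutation′; _⟨$⟩ʳ_)
open import Data.Integer as ℤ using (ℤ)
open import Data.List using (List; []; _∷_; _++_; drop; map; length; lookup)
open import Data.List.Membership.Propositional using (_∈_)
open import Data.List.Relation.Binary.Infix.Heterogeneous using (Infix)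
open import Data.List.Relation.Unary.Linked using (Linked)
open import Data.Nat as ℕ using (ℕ; suc)
open import Data.Product using (∃-syntax; Σ-syntax; ∃₂; _×_; proj₁; proj₂)
open import Data.Sum using (_⊎_)
open import Data.Vec.Functional as Vector using (Vector)
open import Function.Bundles using (_⇔_)
open import Relation.Binary.PropositionalEquality using (_≡_; _≢_)
open import Relation.Nullary using (¬_)
open import Relation.Unary using (Pred; _⊆_; _∩_; _∪_; Satisfiable; ｛_｝)

infix 4 _≼_

_≼_ : ∀ {m n} → Permutation′ m → Permutation′ n → Set
_≼_ {m} {n} π σ = Σ[ f ∈ (Fin m → Fin n) ]
    (∀ {i j : Fin m} → i Fin.< j → f i Fin.< f j)
  × (∀ (i j : Fin m) → (π ⟨$⟩ʳ i) Fin.< (π ⟨$⟩ʳ j) ⇔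
                       (σ ⟨$⟩ʳ f i) Fin.< (σ ⟨$⟩ʳ f j))

Window : ℕ → ℕ → Pred ℕ 0ℓ
Window a b k = a ℕ.≤ k × k ℕ.< b

-- Since σ is a bijection, the values at the positions [a , a + l) form the
-- set [b , c) exactly when i ∈ [a , a + l) is equivalent to σ(i) ∈ [b , c).
-- Positions and values are counted from 0.
Simple : ∀ {n} → Permutation′ n → Set
Simple {n} σ = ∀ a l → 2 ℕ.≤ l → l ℕ.< n → a ℕ.+ l ℕ.≤ n →
  ¬ (∃₂ λ b c → ∀ (i : Fin n) →
       Window a (a ℕ.+ l) (toℕ i) ⇔ Window b c (toℕ (σ ⟨$⟩ʳ i)))

Pin : Set
Pin = ℤ × ℤ

col row : Pin → ℤ
col = proj₁
row = proj₂

data Direction : Set where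
  U D L R : Direction

-- q ∈ Below d p: measured in direction d, q comes strictly before p.
Below : Direction → Pin → Pred Pin 0ℓ
Below U p q = row q ℤ.< row p
Below D p q = row p ℤ.< row q
Below L p q = col p ℤ.< col q
Below R p q = col q ℤ.< col p

SeparatesH SeparatesV Separates : Pin → Pred Pin 0ℓ → Pred Pin 0ℓ → Set
SeparatesH p P Q = (P ⊆ Below U p × Q ⊆ Below D p)
                 ⊎ (P ⊆ Below D p × Q ⊆ Below U p)
SeparatesV p P Q = (P ⊆ Below L p × Q ⊆ Below R p)
                 ⊎ (P ⊆ Below R p × Q ⊆ Below L p)
Separates p P Q = SeparatesH p P Q ⊎ SeparatesV p P Q

-- The horizontal (vertical) line through p misses P and has points of P
-- on both sides.
SplitsH SplitsV : Pin → Pred Pin 0ℓ → Set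
SplitsH p P = P ⊆ (Below U p ∪ Below D p)
            × Satisfiable (P ∩ Below U p) × Satisfiable (P ∩ Below D p)
SplitsV p P = P ⊆ (Below L p ∪ Below R p)
            × Satisfiable (P ∩ Below L p) × Satisfiable (P ∩ Below R p)

Independent : Pin → Pred Pin 0ℓ → Set
Independent p P = ¬ (SplitsH p P ⊎ SplitsV p P)

BoundingBox : Pred Pin 0ℓ → Pred Pin 0ℓ
BoundingBox P q =
    (∃[ l ] P l × col l ℤ.≤ col q) × (∃[ r ] P r × col q ℤ.≤ col r)
  × (∃[ b ] P b × row b ℤ.≤ row q) × (∃[ t ] P t × row q ℤ.≤ row t)

Before : ∀ {n} → Vector Pin n → Fin n → Pred Pin 0ℓ
Before p i q = ∃[ k ] k Fin.< i × p k ≡ q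

record PinSequence {n : ℕ} (p : Vector Pin n) : Set where
  field
    distinct-cols : ∀ {i j} → i ≢ j → col (p i) ≢ col (p j)
    distinct-rows : ∀ {i j} → i ≢ j → row (p i) ≢ row (p j)
    external      : ∀ i → ¬ BoundingBox (Before p i) (p i)
    separates⊎independent : ∀ i j → toℕ i ≡ suc (toℕ j) →
      Separates (p i) ｛ p j ｝ (Before p j) ⊎ Independent (p i) (Before p i)

-- The order in which the pins are listed is unrelated to their order
-- from left to right, so τ matches each pin with a position in σ.
OrderIsomorphic : ∀ {k n} → Vector Pin k → Permutation′ n → Set
OrderIsomorphic {k} {n} p σ = Σ[ τ ∈ Permutation k n ] ∀ i j →
    (col (p i) ℤ.< col (p j) ⇔ (τ ⟨$⟩ʳ i) Fin.< (τ ⟨$⟩ʳ j))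
  × (row (p i) ℤ.< row (p j) ⇔
       (σ ⟨$⟩ʳ (τ ⟨$⟩ʳ i)) Fin.< (σ ⟨$⟩ʳ (τ ⟨$⟩ʳ j)))

PinRepresentation : ∀ {k n} → Vector Pin k → Permutation′ n → Set
PinRepresentation p σ = PinSequence p × OrderIsomorphic p σ

data Numeral : Set where
  q1 q2 q3 q4 : Numeral

data Letter : Set where
  num : Numeral → Letter
  dir : Direction → Letter

Word : Set
Word = List Letter

Beyond : Direction → Pin → Pred Pin 0ℓ → Set
Beyond d p P = P ⊆ Below d p

InCorner : Numeral → Pin → Pred Pin 0ℓ → Set
InCorner q1 p P = Beyond U p P × Beyond R p P
InCorner q2 p P = Beyond U p P × Beyond L p P
InCorner q3 p P = Beyond D p P × Beyond L p P
InCorner q4 p P = Beyond D p P × Beyond R p P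

-- Here p = (p₀ , p₁ , … , pₙ) includes the origin, and index i stands for
-- the pin p (suc i).  The first pin vacuously separates the origin from
-- the empty set, so a direction is not ruled out as its encoding; this is
-- immaterial for words that begin with a numeral.
Encodes : ∀ {n} → Vector Pin (suc n) → Fin n → Letter → Set
Encodes p i (num c) = Independent (p (suc i)) (Before p (suc i))
                    × InCorner c (p (suc i)) (Before p (suc i))
Encodes p i (dir d) =
    Separates (p (suc i)) ｛ p (inject₁ i) ｝ (Before p (inject₁ i))
  × Beyond d (p (suc i)) (Before p (suc i))

Corresponds : ∀ {n} → Word → Permutation′ n → Set
Corresponds w σ = Σ[ p ∈ Vector Pin (length w) ]
    PinRepresentation p σ
  × (∃[ p₀ ] PinSequence (p₀ Vector.∷ p)
           × (∀ i → Encodes (p₀ Vector.∷ p) i (lookup w i)))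

data Strict : Word → Set where
  strict : ∀ q d ds → Strict (num q ∷ map dir (d ∷ ds))

data QuasiStrict : Word → Set where
  quasi-strict : ∀ q r ds → QuasiStrict (num q ∷ num r ∷ map dir ds)

data Axis : Set where
  horizontal vertical : Axis

axis : Direction → Axis
axis U = vertical
axis D = vertical
axis L = horizontal
axis R = horizontal

Alternating : Pred (List Direction) 0ℓ
Alternating = Linked (λ d e → axis d ≢ axis e)

M : Pred (List Direction) 0ℓ
M v = 3 ℕ.≤ length v × Alternating v

φ₂ : Numeral → Direction → List Direction
φ₂ q1 R = R ∷ U ∷ R ∷ []
φ₂ q2 R = L ∷ U ∷ R ∷ []
φ₂ q3 R = L ∷ D ∷ R ∷ []
φ₂ q4 R = R ∷ D ∷ R ∷ []
φ₂ q1 L = R ∷ U ∷ L ∷ []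
φ₂ q2 L = L ∷ U ∷ L ∷ []
φ₂ q3 L = L ∷ D ∷ L ∷ []
φ₂ q4 L = R ∷ D ∷ L ∷ []
φ₂ q1 U = U ∷ R ∷ U ∷ []
φ₂ q2 U = U ∷ L ∷ U ∷ []
φ₂ q3 U = D ∷ L ∷ U ∷ []
φ₂ q4 U = D ∷ R ∷ U ∷ []
φ₂ q1 D = U ∷ R ∷ D ∷ []
φ₂ q2 D = U ∷ L ∷ D ∷ []
φ₂ q3 D = D ∷ L ∷ D ∷ []
φ₂ q4 D = D ∷ R ∷ D ∷ []

φ₁ : Numeral → List (List Direction)
φ₁ q1 = (U ∷ R ∷ []) ∷ (R ∷ U ∷ []) ∷ []
φ₁ q2 = (U ∷ L ∷ []) ∷ (L ∷ U ∷ []) ∷ []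
φ₁ q3 = (D ∷ L ∷ []) ∷ (L ∷ D ∷ []) ∷ []
φ₁ q4 = (R ∷ D ∷ []) ∷ (D ∷ R ∷ []) ∷ []

-- The directions of a strict pin word alternate between the two axes, so
-- strict pin words lie in the domain SP of φ.  The formula for φ does not
-- use alternation and is therefore given for every word of this shape.
φ : ∀ {w} → Strict w → List Direction
φ (strict q d ds) = φ₂ q d ++ ds

-- φ as a set-valued map, to cover single numerals as well.
Φ : Word → Pred (List Direction) 0ℓ
Φ (num q ∷ []) v = v ∈ φ₁ q
Φ w            v = Σ[ s ∈ Strict w ] v ≡ φ s

turns : List (List Direction)
turns = (L ∷ U ∷ []) ∷ (L ∷ D ∷ []) ∷ (R ∷ U ∷ []) ∷ (R ∷ D ∷ [])
      ∷ (U ∷ L ∷ []) ∷ (U ∷ R ∷ []) ∷ (D ∷ L ∷ []) ∷ (D ∷ R ∷ []) ∷ []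

E : ∀ {n} → Permutation′ n → Pred (List Direction) 0ℓ
E π v = (∃[ u ] Σ[ s ∈ Strict u ] Corresponds u π × v ≡ φ s)
      ⊎ (∃[ u ] QuasiStrict u × Corresponds u π × M v
           × (∃₂ λ x y → x ∈ turns × Φ (drop 1 u) y × v ≡ x ++ y))

Factor : List Direction → List Direction → Set
Factor = Infix _≡_

-- Contained in a finite list; not necessarily decidable.
Finite : Pred (List Direction) 0ℓ → Set
Finite P = ∃[ vs ] ∀ {v} → P v → v ∈ vs

-- Let φ(w) = c₀ c₁ … cₙ.  Pin j of w lies beyond all earlier pins in direction
-- cⱼ, and on the other axis it separates pin j - 1, which lies furthest in
-- direction cⱼ₋₁, from the pins before that one.  Hence the order of the pins
-- depends on the letters only, and a factor of φ(w) draws the same pattern as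
-- the corresponding consecutive pins, with any sufficiently early pin in the
-- role of the origin.
--
-- Conversely, let π ≤ σ, let t be the last pin used by an occurrence of π, and
-- b < t the last number before t that is not used.  The pins after number b
-- are outside the bounding box of the pins before number b and separate none
-- of those from each other, so the used pins before b form an interval of π.
-- Since π is simple, there is at most one of them.  If there is none, then
-- c_b … c_t is φ of a strict pin word of π.  If there is one, it can act as an
-- origin of the pins b + 1, …, t, and a quasi-strict pin word of π arises; its
-- two initial letters in E(π) are arbitrary, so c_{b-2} c_{b-1} will do.

module Submission where

open import Defs
open import Level using (0ℓ)
open import Data.Empty using (⊥-elim)
open import Data.Fin as Fin using (Fin; zero; suc; toℕ; inject₁; fromℕ<)
import Data.Fin.Properties as Fin
open import Data.Fin.Permutation as Perm
  using (Permutation; Permutation′; permutation; _⟨$⟩ʳ_; _⟨$⟩ˡ_; inverseˡ; inverseʳ; ↔⇒≡)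
open import Data.Integer as ℤ using (ℤ)
import Data.Integer.Properties as ℤ
open import Data.List using (List; []; _∷_; _++_; map; length; lookup; cartesianProductWith)
open import Data.List.Membership.Propositional using (_∈_)
open import Data.List.Membership.Propositional.Properties using (∈-cartesianProductWith⁺)
import Data.List.Properties as List
import Data.List.Membership.DecPropositional as DecMembership
open import Data.List.Relation.Binary.Infix.Heterogeneous using (here; there)
open import Data.List.Relation.Binary.Prefix.Heterogeneous using (Prefix; []; _∷_)
open import Data.List.Relation.Unary.All as All using (all?)
open import Data.List.Relation.Unary.Any as Any using (here; there)
open import Data.List.Relation.Unary.Linked using ([]; [-]; _∷_)
open import Data.Nat
open import Data.Nat.Properties
open import Data.Product using (∃; ∃-syntax; Σ-syntax; ∃₂; _×_; _,_; proj₁; proj₂; swap)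
open import Data.Sum using (_⊎_; inj₁; inj₂; [_,_]′)
open import Data.Vec.Functional as Vector using (Vector)
open import Function using (_∘_; id; const)
open import Function.Bundles using (_⇔_; mk⇔; module Equivalence)
open import Function.Construct.Composition using (_⇔-∘_)
open import Function.Construct.Symmetry using (⇔-sym)
open import Relation.Binary using (DecidableEquality; tri<; tri≈; tri>)
open import Relation.Binary.PropositionalEquality
open import Relation.Nullary using (Dec; yes; no; ¬_; ¬?; contradiction)
open import Relation.Nullary.Decidable
  using (map′; from-yes; decidable-stable; _×-dec_; _→-dec_)
open import Relation.Unary using (Pred; Decidable; _⊆_; ｛_｝)

open Equivalence using (to; from)

-- Axes and directions

coord : Axis → Pin → ℤ
coord horizontal = col
coord vertical   = row

opposite : Direction → Direction
opposite U = D
opposite D = U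
opposite L = R
opposite R = L

axis-opposite : ∀ d → axis (opposite d) ≡ axis d
axis-opposite U = refl
axis-opposite D = refl
axis-opposite L = refl
axis-opposite R = refl

Below-opposite : ∀ d {p q} → Below d p q → Below (opposite d) q p
Below-opposite U = id
Below-opposite D = id
Below-opposite L = id
Below-opposite R = id

Below-trans : ∀ d {p q r} → Below d p q → Below d q r → Below d p r
Below-trans U x y = ℤ.<-trans y x
Below-trans D x y = ℤ.<-trans x y
Below-trans L x y = ℤ.<-trans x y
Below-trans R x y = ℤ.<-trans y x

Below-asym : ∀ d {p q} → Below d p q → ¬ Below d q p
Below-asym U = ℤ.<-asym
Below-asym D = ℤ.<-asym
Below-asym L = ℤ.<-asym
Below-asym R = ℤ.<-asym

Below-unique : ∀ d e {p q} → axis d ≡ axis e → Below d p q → Below e p q → d ≡ e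
Below-unique U U _ _ _ = refl
Below-unique U D _ x y = contradiction x (ℤ.<-asym y)
Below-unique D U _ x y = contradiction x (ℤ.<-asym y)
Below-unique D D _ _ _ = refl
Below-unique L L _ _ _ = refl
Below-unique L R _ x y = contradiction x (ℤ.<-asym y)
Below-unique R L _ x y = contradiction x (ℤ.<-asym y)
Below-unique R R _ _ _ = refl

_≟ᵃ_ : DecidableEquality Axis
horizontal ≟ᵃ horizontal = yes refl
horizontal ≟ᵃ vertical   = no λ ()
vertical   ≟ᵃ horizontal = no λ ()
vertical   ≟ᵃ vertical   = yes refl

≢-≢⇒≡ : ∀ {a b c : Axis} → a ≢ b → c ≢ b → a ≡ c
≢-≢⇒≡ {horizontal} {_}          {horizontal} _ _ = refl
≢-≢⇒≡ {vertical}   {_}          {vertical}   _ _ = refl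
≢-≢⇒≡ {horizontal} {horizontal} {vertical}   p _ = contradiction refl p
≢-≢⇒≡ {horizontal} {vertical}   {vertical}   _ q = contradiction refl q
≢-≢⇒≡ {vertical}   {horizontal} {horizontal} _ q = contradiction refl q
≢-≢⇒≡ {vertical}   {vertical}   {horizontal} p _ = contradiction refl p

SameOrder : Axis → (p q p′ q′ : Pin) → Set
SameOrder a p q p′ q′ = coord a p ℤ.< coord a q ⇔ coord a p′ ℤ.< coord a q′

both : ∀ {A B : Set} → A → B → A ⇔ B
both x y = mk⇔ (const y) (const x)

neither : ∀ {A B : Set} → ¬ A → ¬ B → A ⇔ B
neither ¬x ¬y = mk⇔ (λ x → contradiction x ¬x) (λ y → contradiction y ¬y)

Below⇒SameOrder : ∀ d {p q p′ q′} → Below d p q → Below d p′ q′ →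
  SameOrder (axis d) p q p′ q′ × SameOrder (axis d) q p q′ p′
Below⇒SameOrder U x y = neither (ℤ.<-asym x) (ℤ.<-asym y) , both x y
Below⇒SameOrder D x y = both x y , neither (ℤ.<-asym x) (ℤ.<-asym y)
Below⇒SameOrder L x y = both x y , neither (ℤ.<-asym x) (ℤ.<-asym y)
Below⇒SameOrder R x y = neither (ℤ.<-asym x) (ℤ.<-asym y) , both x y

Below⇒coord-≢ : ∀ d {p q} → Below d p q → coord (axis d) p ≢ coord (axis d) q
Below⇒coord-≢ U x e = ℤ.<-irrefl (sym e) x
Below⇒coord-≢ D x e = ℤ.<-irrefl e x
Below⇒coord-≢ L x e = ℤ.<-irrefl e x
Below⇒coord-≢ R x e = ℤ.<-irrefl (sym e) x

Below⇒not-between : ∀ d {p q r} → Below d p q → Below d p r →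
  coord (axis d) q ℤ.< coord (axis d) p → ¬ coord (axis d) p ℤ.< coord (axis d) r
Below⇒not-between U _ y _ z = ℤ.<-asym y z
Below⇒not-between D x _ z _ = ℤ.<-asym x z
Below⇒not-between L x _ z _ = ℤ.<-asym x z
Below⇒not-between R _ y _ z = ℤ.<-asym y z

-- The four cases of `Separates` collapse to one direction `f`, which points from `Q` across the
-- line through `p` to `P`.
Separates⇒Below : ∀ {p P Q} → Separates p P Q →
  ∃[ f ] (∀ {q} → P q → Below f q p) × (∀ {q} → Q q → Below f p q)
Separates⇒Below (inj₁ (inj₁ (x , y))) = D , x , y
Separates⇒Below (inj₁ (inj₂ (x , y))) = U , x , y
Separates⇒Below (inj₂ (inj₁ (x , y))) = R , x , y
Separates⇒Below (inj₂ (inj₂ (x , y))) = L , x , y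

Below⇒Separates : ∀ f {p P Q} →
  (∀ {q} → P q → Below f q p) → (∀ {q} → Q q → Below f p q) → Separates p P Q
Below⇒Separates D x y = inj₁ (inj₁ (x , y))
Below⇒Separates U x y = inj₁ (inj₂ (x , y))
Below⇒Separates R x y = inj₂ (inj₁ (x , y))
Below⇒Separates L x y = inj₂ (inj₂ (x , y))

InCorner⇒Independent : ∀ q {p P} → InCorner q p P → Independent p P
InCorner⇒Independent q1 (v , h) = λ where
  (inj₁ (_ , _ , (_ , x , y))) → ℤ.<-asym (v x) y
  (inj₂ (_ , (_ , x , y) , _)) → ℤ.<-asym (h x) y
InCorner⇒Independent q2 (v , h) = λ where
  (inj₁ (_ , _ , (_ , x , y))) → ℤ.<-asym (v x) y
  (inj₂ (_ , _ , (_ , x , y))) → ℤ.<-asym (h x) y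
InCorner⇒Independent q3 (v , h) = λ where
  (inj₁ (_ , (_ , x , y) , _)) → ℤ.<-asym (v x) y
  (inj₂ (_ , _ , (_ , x , y))) → ℤ.<-asym (h x) y
InCorner⇒Independent q4 (v , h) = λ where
  (inj₁ (_ , (_ , x , y) , _)) → ℤ.<-asym (v x) y
  (inj₂ (_ , (_ , x , y) , _)) → ℤ.<-asym (h x) y

InCorner-mono : ∀ q {p P Q} → P ⊆ Q → InCorner q p Q → InCorner q p P
InCorner-mono q1 s (v , h) = (λ x → v (s x)) , (λ x → h (s x))
InCorner-mono q2 s (v , h) = (λ x → v (s x)) , (λ x → h (s x))
InCorner-mono q3 s (v , h) = (λ x → v (s x)) , (λ x → h (s x))
InCorner-mono q4 s (v , h) = (λ x → v (s x)) , (λ x → h (s x))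

Beyond⇒external : ∀ d {p P} → Beyond d p P → ¬ BoundingBox P p
Beyond⇒external U b (_ , _ , _ , (_ , x , le)) = ℤ.<⇒≱ (b x) le
Beyond⇒external D b (_ , _ , (_ , x , le) , _) = ℤ.<⇒≱ (b x) le
Beyond⇒external L b ((_ , x , le) , _) = ℤ.<⇒≱ (b x) le
Beyond⇒external R b (_ , (_ , x , le) , _) = ℤ.<⇒≱ (b x) le

-- The map φ

infix 4 _⊥ᵃ_

_⊥ᵃ_ : Direction → Direction → Set
d ⊥ᵃ e = axis d ≢ axis e

-- Both orders of the two directions of a corner are allowed, since `φ` starts with one or the other
-- depending on the letter that follows.
Quadrant : Numeral → Direction → Direction → Set
Quadrant q a b = (a ∷ b ∷ []) ∈ φ₁ q

InCorner⇔Beyond : ∀ q {a b p P} → Quadrant q a b →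
  InCorner q p P ⇔ (Beyond a p P × Beyond b p P)
InCorner⇔Beyond q1 (here refl)         = mk⇔ id id
InCorner⇔Beyond q1 (there (here refl)) = mk⇔ swap swap
InCorner⇔Beyond q2 (here refl)         = mk⇔ id id
InCorner⇔Beyond q2 (there (here refl)) = mk⇔ swap swap
InCorner⇔Beyond q3 (here refl)         = mk⇔ id id
InCorner⇔Beyond q3 (there (here refl)) = mk⇔ swap swap
InCorner⇔Beyond q4 (here refl)         = mk⇔ swap swap
InCorner⇔Beyond q4 (there (here refl)) = mk⇔ id id

directions : List Direction
directions = U ∷ D ∷ L ∷ R ∷ []

∈-directions : ∀ d → d ∈ directions
∈-directions U = here refl
∈-directions D = there (here refl)
∈-directions L = there (there (here refl))
∈-directions R = there (there (there (here refl)))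

_≟ᵈ_ : DecidableEquality Direction
d ≟ᵈ e = map′ (position-injective d e) (cong position) (position d ≟ position e)
  where
  position : Direction → ℕ
  position U = 0
  position D = 1
  position L = 2
  position R = 3

  position-injective : ∀ d e → position d ≡ position e → d ≡ e
  position-injective U U _ = refl
  position-injective D D _ = refl
  position-injective L L _ = refl
  position-injective R R _ = refl

open DecMembership (List.≡-dec _≟ᵈ_) using (_∈?_)

⊥ᵃ? : ∀ d e → Dec (d ⊥ᵃ e)
⊥ᵃ? d e = ¬? (axis d ≟ᵃ axis e)

-- There are four directions, so claims about a few letters are decidable and `from-yes` can prove
-- them by evaluation.
∀? : {P : Pred Direction 0ℓ} → Decidable P → Dec (∀ d → P d)
∀? P? = map′ (λ ps d → All.lookup ps (∈-directions d)) (λ ps → All.universal ps _)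
  (all? P? directions)

∃-numeral? : {P : Pred Numeral 0ℓ} → Decidable P → Dec (Any.Any P (q1 ∷ q2 ∷ q3 ∷ q4 ∷ []))
∃-numeral? P? = Any.any? P? _

Quadrant⇒⊥ : ∀ q {a b} → Quadrant q a b → a ⊥ᵃ b
Quadrant⇒⊥ q1 (here refl)         ()
Quadrant⇒⊥ q1 (there (here refl)) ()
Quadrant⇒⊥ q2 (here refl)         ()
Quadrant⇒⊥ q2 (there (here refl)) ()
Quadrant⇒⊥ q3 (here refl)         ()
Quadrant⇒⊥ q3 (there (here refl)) ()
Quadrant⇒⊥ q4 (here refl)         ()
Quadrant⇒⊥ q4 (there (here refl)) ()

-- Of the two orders of a corner, `φ₂` takes the one whose second direction is perpendicular to `d`,
-- so that the three letters alternate.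
φ₂-quadrant : ∀ q d → ∃₂ λ a b → Quadrant q a b × b ⊥ᵃ d × φ₂ q d ≡ a ∷ b ∷ d ∷ []
φ₂-quadrant q1 U = _ , _ , here refl         , (λ ()) , refl
φ₂-quadrant q1 D = _ , _ , here refl         , (λ ()) , refl
φ₂-quadrant q1 L = _ , _ , there (here refl) , (λ ()) , refl
φ₂-quadrant q1 R = _ , _ , there (here refl) , (λ ()) , refl
φ₂-quadrant q2 U = _ , _ , here refl         , (λ ()) , refl
φ₂-quadrant q2 D = _ , _ , here refl         , (λ ()) , refl
φ₂-quadrant q2 L = _ , _ , there (here refl) , (λ ()) , refl
φ₂-quadrant q2 R = _ , _ , there (here refl) , (λ ()) , refl
φ₂-quadrant q3 U = _ , _ , here refl         , (λ ()) , refl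
φ₂-quadrant q3 D = _ , _ , here refl         , (λ ()) , refl
φ₂-quadrant q3 L = _ , _ , there (here refl) , (λ ()) , refl
φ₂-quadrant q3 R = _ , _ , there (here refl) , (λ ()) , refl
φ₂-quadrant q4 U = _ , _ , there (here refl) , (λ ()) , refl
φ₂-quadrant q4 D = _ , _ , there (here refl) , (λ ()) , refl
φ₂-quadrant q4 L = _ , _ , here refl         , (λ ()) , refl
φ₂-quadrant q4 R = _ , _ , here refl         , (λ ()) , refl

-- `a` and `b` determine the corner, and `b ⊥ᵃ d` says that they come in the order that `φ₂`
-- selects. This is what reads a factor of `φ s` back as a pin word.
φ₂-surjective : ∀ a b d → a ⊥ᵃ b → b ⊥ᵃ d →
  ∃[ q ] Quadrant q a b × φ₂ q d ≡ a ∷ b ∷ d ∷ []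
φ₂-surjective a b d p q = Any.satisfied (table a b d p q)
  where
  table : ∀ a b d → a ⊥ᵃ b → b ⊥ᵃ d →
    Any.Any (λ q → Quadrant q a b × φ₂ q d ≡ a ∷ b ∷ d ∷ []) (q1 ∷ q2 ∷ q3 ∷ q4 ∷ [])
  table = from-yes (∀? λ a → ∀? λ b → ∀? λ d → ⊥ᵃ? a b →-dec ⊥ᵃ? b d →-dec
    ∃-numeral? λ q → ((a ∷ b ∷ []) ∈? φ₁ q)
      ×-dec List.≡-dec _≟ᵈ_ (φ₂ q d) (a ∷ b ∷ d ∷ []))

⊥⇒Quadrant : ∀ a b → a ⊥ᵃ b → ∃[ q ] Quadrant q a b
⊥⇒Quadrant a b a⊥b with q , ab∈q , _ ← φ₂-surjective a b a a⊥b (a⊥b ∘ sym) = q , ab∈q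

⊥⇒turn : ∀ a b → a ⊥ᵃ b → (a ∷ b ∷ []) ∈ turns
⊥⇒turn = from-yes (∀? λ a → ∀? λ b → ⊥ᵃ? a b →-dec ((a ∷ b ∷ []) ∈? turns))

dir-injective : ∀ {d e} → dir d ≡ dir e → d ≡ e
dir-injective refl = refl

-- The value U beyond the end is junk.

letter : List Direction → ℕ → Direction
letter []       _       = U
letter (d ∷ _)  zero    = d
letter (_ ∷ ds) (suc k) = letter ds k

dirs : Numeral → List Direction → Word
dirs q ds = num q ∷ map dir ds

-- The shape of `w` is given by an equation because matching on a `Strict (dirs q ds)` would have to
-- unify two applications of `map`.
Strict⇒dirs : ∀ {w} (s : Strict w) →
  ∃[ q ] ∃[ d ] ∃[ ds ] w ≡ dirs q (d ∷ ds) × φ s ≡ φ₂ q d ++ ds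
Strict⇒dirs (strict q d ds) = q , d , ds , refl , refl

Φ⇒Quadrant : ∀ {q} ds {y} → Φ (dirs q ds) y →
  ∃₂ λ a b → Quadrant q a b × (0 < length ds → b ⊥ᵃ letter ds 0) × y ≡ a ∷ b ∷ ds
Φ⇒Quadrant {q1} [] (here refl)         = _ , _ , here refl , (λ ()) , refl
Φ⇒Quadrant {q1} [] (there (here refl)) = _ , _ , there (here refl) , (λ ()) , refl
Φ⇒Quadrant {q2} [] (here refl)         = _ , _ , here refl , (λ ()) , refl
Φ⇒Quadrant {q2} [] (there (here refl)) = _ , _ , there (here refl) , (λ ()) , refl
Φ⇒Quadrant {q3} [] (here refl)         = _ , _ , here refl , (λ ()) , refl
Φ⇒Quadrant {q3} [] (there (here refl)) = _ , _ , there (here refl) , (λ ()) , refl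
Φ⇒Quadrant {q4} [] (here refl)         = _ , _ , here refl , (λ ()) , refl
Φ⇒Quadrant {q4} [] (there (here refl)) = _ , _ , there (here refl) , (λ ()) , refl
Φ⇒Quadrant {q} (d ∷ ds) (s , refl) with Strict⇒dirs s
... | q′ , d′ , ds′ , w≡ , φ≡
  with refl , ds≡ ← List.∷-injective w≡
  with refl ← List.map-injective dir-injective ds≡
  with a , b , ab∈q , b⊥d , φ₂≡ ← φ₂-quadrant q d
  = a , b , ab∈q , const b⊥d , trans φ≡ (cong (_++ ds) φ₂≡)

-- Spirals

-- The pins S 1, …, S n around the origin S 0, in the numbering in which
-- c 0, …, c n are the letters of φ(w): pin j lies beyond all earlier ones in
-- direction c j, and pin j + 1 separates pin j from the earlier ones along
-- the axis of c j.  The cutoff k ≤ pred j stands for k < j, except that the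
-- first pin is also beyond the origin in direction c 0.
record Spiral (c : ℕ → Direction) (S : ℕ → Pin) (n : ℕ) : Set where
  field
    bend   : ∀ {j} → j < n → c j ⊥ᵃ c (suc j)
    beyond : ∀ {k j} → k < j → j ≤ n → Below (c j) (S j) (S k)
    past   : ∀ {k j} → k ≤ pred j → j < n → Below (c j) (S (suc j)) (S k)
    short  : ∀ {j} → 0 < j → j < n → Below (c j) (S j) (S (suc j))

open Spiral

-- Along `f` the point `p′` lies between `p` and `o`; along `d` it lies beyond both. No single axis
-- allows the two together.
separator-⊥ : ∀ {d f p p′ o} →
  Below f p p′ → Below f p′ o → Below d p′ p → Below d p′ o → f ⊥ᵃ d
separator-⊥ {d} {f} pf of pd od f∥d
  with refl ← Below-unique f d f∥d of od = Below-asym f pf pd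

-- With only two axes, `f` must be parallel to `e`. Transitivity puts `p` beyond `o` in direction
-- `f` as well as in direction `e`, which settles the sign.
separator-direction : ∀ {d e f p p′ o} → e ⊥ᵃ d → Below e p o →
  Below f p p′ → Below f p′ o → Below d p′ p → Below d p′ o → f ≡ e
separator-direction {d} {e} {f} e⊥d pe pf of pd od =
  Below-unique f e (≢-≢⇒≡ (separator-⊥ {d} {f} pf of pd od) e⊥d) (Below-trans f pf of) pe

-- If e and d were parallel, then so would be f and b, and p′ would have to
-- lie between p and both r and o, although p lies between r and o.
separators-bend : ∀ {b d e f p p′ o r} → b ⊥ᵃ e → Below b p o → Below b r p →
  Below f p p′ → Below f p′ o → Below f p′ r → Below d p′ p → Below d p′ o → e ⊥ᵃ d
separators-bend {b} {d} {e} {f} b⊥e pb rb pf of rf pd od e∥d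
  with refl ← Below-unique f b
    (≢-≢⇒≡ (λ f∥e → separator-⊥ {d} {f} pf of pd od (trans f∥e e∥d)) b⊥e)
    (Below-trans f pf of) pb
  = Below-asym f rb (Below-trans f pf rf)

-- Alternation is derived here: the first two bends are given, and each later one follows from its
-- predecessor by `separators-bend`. Each bend identifies the unknown separating direction `f` with
-- `c j`, which yields `past` and `short`.
spiral : ∀ {c S n} → c 0 ⊥ᵃ c 1 → (1 < n → c 1 ⊥ᵃ c 2) →
  Below (c 0) (S 1) (S 0) → Below (c 1) (S 1) (S 0) →
  (∀ {j} → 0 < j → j < n → ∃[ f ] Below f (S j) (S (suc j)) ×
     (∀ {k} → k < j → Below f (S (suc j)) (S k))) →
  (∀ {j} → 0 < j → j < n → ∀ {k} → k ≤ j → Below (c (suc j)) (S (suc j)) (S k)) →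
  Spiral c S n
spiral {c} {S} {n} bend₀ bend₁ first₀ first₁ separated extreme = record
  { bend   = bends _
  ; beyond = extremes
  ; past   = pasts
  ; short  = λ 0<j j<n → proj₁ (along 0<j j<n (bends _ j<n))
  }
  where
  extremes : ∀ {k j} → k < j → j ≤ n → Below (c j) (S j) (S k)
  extremes {zero}  {suc zero}    _         _   = first₁
  extremes {suc k} {suc zero}    (s≤s ())  _
  extremes {k}     {suc (suc j)} (s≤s k≤j) j≤n = extreme z<s j≤n k≤j

  along : ∀ {j} → 0 < j → j < n → c j ⊥ᵃ c (suc j) →
    Below (c j) (S j) (S (suc j)) × (∀ {k} → k < j → Below (c j) (S (suc j)) (S k))
  along 0<j j<n j⊥ with f , pf , of ← separated 0<j j<n
    with refl ← separator-direction {f = f} j⊥ (extremes 0<j (<⇒≤ j<n)) pf (of 0<j)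
                  (extreme 0<j j<n ≤-refl) (extreme 0<j j<n z≤n)
    = pf , of

  bend-again : ∀ {j} → 0 < j → suc j < n → c j ⊥ᵃ c (suc j) → c (suc j) ⊥ᵃ c (suc (suc j))
  bend-again 0<j j<n j⊥ with f , pf , of ← separated z<s j<n
    with rb , ob ← along 0<j (<⇒≤ j<n) j⊥
    = separators-bend {f = f} j⊥ (ob 0<j) rb pf (of z<s) (of ≤-refl)
        (extreme z<s j<n ≤-refl) (extreme z<s j<n z≤n)

  bends : ∀ j → j < n → c j ⊥ᵃ c (suc j)
  bends zero          _   = bend₀
  bends (suc zero)    1<n = bend₁ 1<n
  bends (suc (suc j)) j<n = bend-again z<s j<n (bends (suc j) (<⇒≤ j<n))

  pasts : ∀ {k j} → k ≤ pred j → j < n → Below (c j) (S (suc j)) (S k)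
  pasts {zero} {zero} _ _     = first₀
  pasts {_}   {suc j} k≤j j<n = proj₂ (along z<s j<n (bends _ j<n)) (s≤s k≤j)

Spiral-cong : ∀ {c c′ S n} → (∀ {j} → j ≤ n → c j ≡ c′ j) → Spiral c S n → Spiral c′ S n
Spiral-cong c≗c′ s = record
  { bend   = λ j<n → subst₂ _⊥ᵃ_ (c≗c′ (<⇒≤ j<n)) (c≗c′ j<n) (s .bend j<n)
  ; beyond = λ k<j j≤n → subst (λ d → Below d _ _) (c≗c′ j≤n) (s .beyond k<j j≤n)
  ; past   = λ k≤j j<n → subst (λ d → Below d _ _) (c≗c′ (<⇒≤ j<n)) (s .past k≤j j<n)
  ; short  = λ 0<j j<n → subst (λ d → Below d _ _) (c≗c′ (<⇒≤ j<n)) (s .short 0<j j<n)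
  }

restart : (ℕ → Pin) → ℕ → ℕ → ℕ → Pin
restart S b a zero    = S b
restart S b a (suc j) = S (suc (a + j))

-- Any pin up to number pred a can serve as an origin for the pins after
-- number a.
Spiral-restart : ∀ {c S N b a n} → Spiral c S N → b ≤ pred a → a + n ≤ N →
  Spiral (c ∘ (a +_)) (restart S b a) n
Spiral-restart {c} {S} {N} {b} {a} {n} s b≤a a+n≤N = record
  { bend   = λ {j} j<n → subst (λ i → c (a + j) ⊥ᵃ c i) (sym (+-suc a j)) (s .bend (bound j<n))
  ; beyond = beyond′
  ; past   = past′
  ; short  = short′
  }
  where
  bound : ∀ {j} → j < n → a + j < N
  bound {j} j<n = ≤-trans (+-monoʳ-< a j<n) a+n≤N

  b≤ : b ≤ a
  b≤ = ≤-trans b≤a pred[n]≤n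

  beyond′ : ∀ {k j} → k < j → j ≤ n →
    Below (c (a + j)) (restart S b a j) (restart S b a k)
  beyond′ {zero} {suc j} _ j≤n rewrite +-suc a j =
    s .beyond (s≤s (≤-trans b≤ (m≤m+n a j))) (bound j≤n)
  beyond′ {suc k} {suc j} (s≤s k<j) j≤n rewrite +-suc a j =
    s .beyond (s≤s (+-monoʳ-< a k<j)) (bound j≤n)

  past′ : ∀ {k j} → k ≤ pred j → j < n →
    Below (c (a + j)) (S (suc (a + j))) (restart S b a k)
  past′ {zero} {j} _ j<n = s .past (≤-trans b≤a (pred-mono-≤ (m≤m+n a j))) (bound j<n)
  past′ {suc k} {suc j} k<j j<n =
    s .past (≤-trans (+-monoʳ-< a k<j) (≤-reflexive (cong pred (sym (+-suc a j))))) (bound j<n)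

  short′ : ∀ {j} → 0 < j → j < n →
    Below (c (a + j)) (restart S b a j) (S (suc (a + j)))
  short′ {suc j} _ j<n =
    subst (λ i → Below (c (a + suc j)) (S i) (S (suc (a + suc j)))) (+-suc a j)
      (s .short (≤-trans (s≤s z≤n) (m≤n+m (suc j) a)) (bound j<n))

-- Where an earlier pin lies relative to a later one depends on the letters
-- only.
locate : ∀ {c S n k j} → Spiral c S n → k < j → j ≤ n → ∀ a →
  ∃[ d ] axis d ≡ a × (∀ {S′} → Spiral c S′ n → Below d (S′ j) (S′ k))
locate {c} {k = k} {suc i} s k<j j≤n a with a ≟ᵃ axis (c (suc i)) | k ≤? pred i
... | yes refl | _ = c (suc i) , refl , λ s′ → s′ .beyond k<j j≤n
... | no a≢ | yes k≤ = c i , ≢-≢⇒≡ (s .bend j≤n) a≢ , λ s′ → s′ .past k≤ j≤n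
-- Only the direct predecessor is left. It reaches further in direction `c k` than its successor,
-- hence `opposite`. The origin never gets here, as `pred 0` is 0.
... | no a≢ | no k≰ with i
... | zero = contradiction (s≤s⁻¹ k<j) k≰
... | suc i′ with refl ← ≤-antisym (s≤s⁻¹ k<j) (≰⇒> k≰) =
  opposite (c k) , trans (axis-opposite (c k)) (≢-≢⇒≡ (s .bend j≤n) a≢) ,
  λ s′ → Below-opposite (c k) (s′ .short z<s j≤n)

-- `locate` fixes a direction before the placement of the pins is chosen, so one direction serves
-- `S` and `S′` at once.
Spiral-rigid : ∀ {c S S′ n} → Spiral c S n → Spiral c S′ n →
  ∀ a {i j} → i ≤ n → j ≤ n → SameOrder a (S i) (S j) (S′ i) (S′ j)
Spiral-rigid s s′ a {i} {j} i≤n j≤n with <-cmp i j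
... | tri< i<j _ _ with d , refl , below ← locate s i<j j≤n a =
  proj₂ (Below⇒SameOrder d (below s) (below s′))
... | tri≈ _ refl _ = neither (ℤ.<-irrefl refl) (ℤ.<-irrefl refl)
... | tri> _ _ j<i with d , refl , below ← locate s j<i i≤n a =
  proj₁ (Below⇒SameOrder d (below s) (below s′))

Spiral-distinct : ∀ {c S n} → Spiral c S n →
  ∀ a {i j} → i ≤ n → j ≤ n → i ≢ j → coord a (S i) ≢ coord a (S j)
Spiral-distinct s a {i} {j} i≤n j≤n i≢j with <-cmp i j
... | tri< i<j _ _ with d , refl , below ← locate s i<j j≤n a =
  Below⇒coord-≢ d (below s) ∘ sym
... | tri≈ _ i≡j _ = contradiction i≡j i≢j
... | tri> _ _ j<i with d , refl , below ← locate s j<i i≤n a =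
  Below⇒coord-≢ d (below s)

-- Pin `suc j` can cut only between pin `j` and the rest. This is the source of the intervals in
-- `π`: they appear once a number is skipped.
outside : ∀ {c S n j} → Spiral c S n → j < n → ∀ a →
  ∃[ d ] axis d ≡ a × (∀ {k} → k ≤ pred j → Below d (S (suc j)) (S k))
outside {c} {j = j} s j<n a with a ≟ᵃ axis (c (suc j))
... | yes refl = c (suc j) , refl , λ k≤ → s .beyond (s≤s (≤-trans k≤ pred[n]≤n)) j<n
... | no a≢ = c j , ≢-≢⇒≡ (s .bend j<n) a≢ , λ k≤ → s .past k≤ j<n

-- Pin sequences as spirals

-- Turns a vector of pins into a function on ℕ, as `Spiral` expects; indices above `n` repeat the
-- last entry.
clamp : ∀ {n} → ℕ → Fin (suc n)
clamp {zero}  _       = zero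
clamp {suc _} zero    = zero
clamp {suc _} (suc k) = suc (clamp k)

toℕ-clamp : ∀ {n k} → k ≤ n → toℕ (clamp {n} k) ≡ k
toℕ-clamp {zero}  z≤n       = refl
toℕ-clamp {suc _} z≤n       = refl
toℕ-clamp {suc _} (s≤s k≤n) = cong suc (toℕ-clamp k≤n)

clamp-toℕ : ∀ {n} (i : Fin (suc n)) → clamp (toℕ i) ≡ i
clamp-toℕ {n} i = Fin.toℕ-injective (toℕ-clamp (s≤s⁻¹ (Fin.toℕ<n i)))

inject₁-clamp : ∀ {n k} → k ≤ n → inject₁ (clamp {n} k) ≡ clamp {suc n} k
inject₁-clamp k≤n = Fin.toℕ-injective
  (trans (Fin.toℕ-inject₁ _) (trans (toℕ-clamp k≤n) (sym (toℕ-clamp (m≤n⇒m≤1+n k≤n)))))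

lookup-dir : ∀ ds i → lookup (map dir ds) i ≡ dir (letter ds (toℕ i))
lookup-dir (_ ∷ _)  zero    = refl
lookup-dir (_ ∷ ds) (suc i) = lookup-dir ds i

lookup-dirs : ∀ q ds {j} (i : Fin (length (dirs q ds))) → toℕ i ≡ suc j →
  lookup (dirs q ds) i ≡ dir (letter ds j)
lookup-dirs q ds (suc i) refl = lookup-dir ds i

-- Dropping the origin shrinks the sets of earlier pins. Corners and separation pass to smaller
-- sets; independence is recovered from the corner.
Encodes-tail : ∀ {n} (x : Vector Pin (suc (suc n))) i l →
  Encodes x (suc i) l → Encodes (Vector.tail x) i l
Encodes-tail x i (num q) (_ , c) = InCorner⇒Independent q c′ , c′
  where c′ = InCorner-mono q (λ (k , k<i , e) → suc k , s≤s k<i , e) c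
Encodes-tail x i (dir d) (s , b) with f , p , o ← Separates⇒Below s =
  Below⇒Separates f p (λ (k , k<i , e) → o (suc k , s≤s k<i , e)) ,
  λ (k , k<i , e) → b (suc k , s≤s k<i , e)

-- The numeral accounts for letters 0 and 1 of `y`, so entry `j` of `ds` is letter `2 + j` and
-- belongs to pin `2 + j`.
Encodes⇒Spiral : ∀ q ds {y} (x : Vector Pin (suc (length (dirs q ds)))) →
  (∀ i → Encodes x i (lookup (dirs q ds) i)) → Φ (dirs q ds) y →
  Spiral (letter y) (x ∘ clamp) (length (dirs q ds))
Encodes⇒Spiral q ds x enc Φy with a , b , ab∈q , b⊥ds , refl ← Φ⇒Quadrant ds Φy =
  spiral (Quadrant⇒⊥ q ab∈q) (λ 1<n → b⊥ds (subst (0 <_) (List.length-map dir ds) (s≤s⁻¹ 1<n)))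
    (first proj₁) (first proj₂) separated extreme
  where
  n′ : ℕ
  n′ = length (map dir ds)

  first : ∀ {d} → (Beyond a (x (suc zero)) (Before x (suc zero)) ×
                   Beyond b (x (suc zero)) (Before x (suc zero)) →
                   Beyond d (x (suc zero)) (Before x (suc zero))) →
    Below d (x (suc (clamp 0))) (x zero)
  -- `clamp 0` is stuck, because `clamp` first inspects the length, here `n′`.
  first {d} π = subst (λ i → Below d (x (suc i)) (x zero)) (sym (clamp-toℕ zero))
    (π (to (InCorner⇔Beyond q ab∈q) (proj₂ (enc zero))) (zero , s≤s z≤n , refl))

  encoded : ∀ {j} → suc j ≤ n′ → Encodes x (clamp (suc j)) (dir (letter ds j))
  encoded j≤n′ = subst (Encodes x _) (lookup-dirs q ds _ (toℕ-clamp j≤n′)) (enc _)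

  before : ∀ {k j} → k < j → j ≤ suc n′ → Before x (clamp j) (x (clamp k))
  before k<j j≤n = clamp _ ,
    subst₂ _<_ (sym (toℕ-clamp (≤-trans (<⇒≤ k<j) j≤n))) (sym (toℕ-clamp j≤n)) k<j , refl

  separated : ∀ {j} → 0 < j → j < suc n′ → ∃[ f ]
    Below f (x (clamp j)) (x (suc (clamp j))) ×
    (∀ {k} → k < j → Below f (x (suc (clamp j))) (x (clamp k)))
  separated {suc j} _ (s≤s j≤n′)
    with f , p , o ← Separates⇒Below (proj₁ (encoded j≤n′)) =
    f , p (cong x (inject₁-clamp j≤n′)) ,
    λ k<j → o (subst (λ i → Before x i _) (sym (inject₁-clamp j≤n′))
      (before k<j (m≤n⇒m≤1+n j≤n′)))

  extreme : ∀ {j} → 0 < j → j < suc n′ → ∀ {k} → k ≤ j →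
    Below (letter (a ∷ b ∷ ds) (suc j)) (x (suc (clamp j))) (x (clamp k))
  extreme {suc j} _ (s≤s j≤n′) k≤j = proj₂ (encoded j≤n′) (before (s≤s k≤j) (s≤s j≤n′))

Encodes⇒external : ∀ {n} (x : Vector Pin (suc n)) i l → Encodes x i l →
  ¬ BoundingBox (Before x (suc i)) (x (suc i))
Encodes⇒external x i (dir d) (_ , b) = Beyond⇒external d b
Encodes⇒external x i (num q1) (_ , b , _) = Beyond⇒external U b
Encodes⇒external x i (num q2) (_ , b , _) = Beyond⇒external U b
Encodes⇒external x i (num q3) (_ , b , _) = Beyond⇒external D b
Encodes⇒external x i (num q4) (_ , b , _) = Beyond⇒external D b

Encodes⇒separates⊎independent : ∀ {n} (x : Vector Pin (suc n)) i l → Encodes x i l →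
  Separates (x (suc i)) ｛ x (inject₁ i) ｝ (Before x (inject₁ i)) ⊎
  Independent (x (suc i)) (Before x (suc i))
Encodes⇒separates⊎independent x i (dir _) (s , _) = inj₁ s
Encodes⇒separates⊎independent x i (num _) (s , _) = inj₂ s

Encodes⇒PinSequence : ∀ {n} (x : Vector Pin (suc n)) {l : Fin n → Letter} →
  (∀ i → Encodes x i (l i)) → (∀ a {i j} → i ≢ j → coord a (x i) ≢ coord a (x j)) →
  PinSequence x
Encodes⇒PinSequence x {l} enc distinct = record
  { distinct-cols = distinct horizontal
  ; distinct-rows = distinct vertical
  ; external = λ where
      zero    ((_ , (_ , () , _) , _) , _)
      (suc i) → Encodes⇒external x i (l i) (enc i)
  ; separates⊎independent = λ where
      (suc i) j i≡ → subst
        (λ j → Separates (x (suc i)) ｛ x j ｝ (Before x j) ⊎ Independent (x (suc i)) (Before x (suc i)))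
        (Fin.toℕ-injective (trans (Fin.toℕ-inject₁ i) (suc-injective i≡)))
        (Encodes⇒separates⊎independent x i (l i) (enc i))
  }

-- `Corresponds` demands a pin sequence without the origin too; there the first pin takes the place
-- of the origin.
Encodes⇒PinSequence-tail : ∀ {n} (x : Vector Pin (suc n)) {l : Fin n → Letter} →
  (∀ i → Encodes x i (l i)) → (∀ a {i j} → i ≢ j → coord a (x i) ≢ coord a (x j)) →
  PinSequence (Vector.tail x)
Encodes⇒PinSequence-tail {zero} x enc distinct = record
  { distinct-cols = λ {i} → contradiction i Fin.¬Fin0
  ; distinct-rows = λ {i} → contradiction i Fin.¬Fin0
  ; external = λ ()
  ; separates⊎independent = λ ()
  }
Encodes⇒PinSequence-tail {suc n} x {l} enc distinct =
  Encodes⇒PinSequence (Vector.tail x) (λ i → Encodes-tail x i (l (suc i)) (enc (suc i)))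
    (λ a i≢j → distinct a (i≢j ∘ Fin.suc-injective))

-- Permutations drawn by pins

<⇔ : ∀ {m n} {f : Fin m → Fin n} → (∀ {i j} → i Fin.< j → f i Fin.< f j) →
  ∀ {i j} → i Fin.< j ⇔ f i Fin.< f j
<⇔ {f = f} mono {i} {j} = mk⇔ mono reflect
  where
  reflect : f i Fin.< f j → i Fin.< j
  reflect fi<fj with Fin.<-cmp i j
  ... | tri< i<j _ _  = i<j
  ... | tri≈ _ refl _ = contradiction fi<fj (Fin.<-irrefl refl)
  ... | tri> _ _ j<i  = contradiction fi<fj (Fin.<-asym (mono j<i))

-- The matchings pass between pins and positions: agreement of columns makes `f` increasing,
-- agreement of rows makes it respect values.
SameOrder⇒≼ : ∀ {k l m n} {p : Vector Pin k} {q : Vector Pin l}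
  {π : Permutation′ m} {σ : Permutation′ n} →
  OrderIsomorphic p π → OrderIsomorphic q σ → (e : Fin k → Fin l) →
  (∀ a i j → SameOrder a (p i) (p j) (q (e i)) (q (e j))) → π ≼ σ
SameOrder⇒≼ {p = p} {q} {π} {σ} (τ , p≅π) (υ , q≅σ) e same =
  f , (λ i<j → to (positions _ _) i<j) , values
  where
  f = λ i → υ ⟨$⟩ʳ e (τ ⟨$⟩ˡ i)

  positions : ∀ i j → i Fin.< j ⇔ f i Fin.< f j
  positions i j = proj₁ (q≅σ _ _) ⇔-∘ (same horizontal _ _ ⇔-∘
    subst₂ (λ i′ j′ → i′ Fin.< j′ ⇔ col (p (τ ⟨$⟩ˡ i)) ℤ.< col (p (τ ⟨$⟩ˡ j)))
      (inverseʳ τ) (inverseʳ τ) (⇔-sym (proj₁ (p≅π _ _))))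

  values : ∀ i j → (π ⟨$⟩ʳ i) Fin.< (π ⟨$⟩ʳ j) ⇔ (σ ⟨$⟩ʳ f i) Fin.< (σ ⟨$⟩ʳ f j)
  values i j = proj₂ (q≅σ _ _) ⇔-∘ (same vertical _ _ ⇔-∘
    subst₂ (λ i′ j′ → (π ⟨$⟩ʳ i′) Fin.< (π ⟨$⟩ʳ j′) ⇔ row (p (τ ⟨$⟩ˡ i)) ℤ.< row (p (τ ⟨$⟩ˡ j)))
      (inverseʳ τ) (inverseʳ τ) (⇔-sym (proj₂ (p≅π _ _))))

-- `OrderIsomorphic` with the identity as matching: the pins are listed by position in `π`, not in
-- the order of a pin sequence.
Drawn : ∀ {m} → Vector Pin m → Permutation′ m → Set
Drawn p π = ∀ i j → (col (p i) ℤ.< col (p j) ⇔ i Fin.< j)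
                  × (row (p i) ℤ.< row (p j) ⇔ (π ⟨$⟩ʳ i) Fin.< (π ⟨$⟩ʳ j))

≼⇒Drawn : ∀ {l m n} {q : Vector Pin l} {π : Permutation′ m} {σ : Permutation′ n} →
  OrderIsomorphic q σ → π ≼ σ → ∃[ g ] Drawn (q ∘ g) π
≼⇒Drawn {q = q} {σ = σ} (υ , q≅σ) (f , mono , values) =
  g , λ i j →
    (⇔-sym (<⇔ mono) ⇔-∘
      subst₂ (λ i′ j′ → col (q (g i)) ℤ.< col (q (g j)) ⇔ i′ Fin.< j′)
        (inverseʳ υ) (inverseʳ υ) (proj₁ (q≅σ _ _))) ,
    (⇔-sym (values i j) ⇔-∘
      subst₂ (λ i′ j′ → row (q (g i)) ℤ.< row (q (g j)) ⇔ (σ ⟨$⟩ʳ i′) Fin.< (σ ⟨$⟩ʳ j′))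
        (inverseʳ υ) (inverseʳ υ) (proj₂ (q≅σ _ _)))
  where
  g = λ i → υ ⟨$⟩ˡ f i

Drawn⇒OrderIsomorphic : ∀ {l m} {p : Vector Pin m} {p′ : Vector Pin l} {π : Permutation′ m} →
  Drawn p π → (ρ : Permutation l m) → (∀ i → p (ρ ⟨$⟩ʳ i) ≡ p′ i) → OrderIsomorphic p′ π
Drawn⇒OrderIsomorphic {p = p} {p′} {π} drawn ρ p∘ρ≗p′ = ρ , λ i j →
  subst₂ (λ u v → (col u ℤ.< col v ⇔ (ρ ⟨$⟩ʳ i) Fin.< (ρ ⟨$⟩ʳ j)) ×
                  (row u ℤ.< row v ⇔ (π ⟨$⟩ʳ (ρ ⟨$⟩ʳ i)) Fin.< (π ⟨$⟩ʳ (ρ ⟨$⟩ʳ j))))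
    (p∘ρ≗p′ i) (p∘ρ≗p′ j) (drawn (ρ ⟨$⟩ʳ i) (ρ ⟨$⟩ʳ j))

enumeration : ∀ {l m} (f : Fin l → ℕ) (g : Fin m → ℕ) →
  (∀ {i j} → f i ≡ f j → i ≡ j) → (∀ {i j} → g i ≡ g j → i ≡ j) →
  (∀ i → ∃[ j ] g j ≡ f i) → (∀ j → ∃[ i ] f i ≡ g j) →
  Σ[ ρ ∈ Permutation l m ] ∀ i → g (ρ ⟨$⟩ʳ i) ≡ f i
enumeration f g f-inj g-inj f⊆g g⊆f =
  permutation (proj₁ ∘ f⊆g) (proj₁ ∘ g⊆f)
    (λ j → g-inj (trans (proj₂ (f⊆g _)) (proj₂ (g⊆f j))))
    (λ i → f-inj (trans (proj₂ (g⊆f _)) (proj₂ (f⊆g i)))) ,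
  proj₂ ∘ f⊆g

-- Factors

words : ℕ → List (List Direction)
words zero    = [] ∷ []
words (suc l) = [] ∷ cartesianProductWith _∷_ directions (words l)

∈-words : ∀ {l} v → length v ≤ l → v ∈ words l
∈-words {zero}  []      _         = here refl
∈-words {suc l} []      _         = here refl
∈-words {suc l} (d ∷ v) (s≤s v≤l) =
  there (∈-cartesianProductWith⁺ _∷_ (∈-directions d) (∈-words v v≤l))

Φ-length : ∀ q ds {y} → Φ (dirs q ds) y → length y ≡ suc (length (dirs q ds))
Φ-length q ds Φy with _ , _ , _ , _ , refl ← Φ⇒Quadrant ds Φy =
  cong (2 +_) (sym (List.length-map dir ds))

Turn : List Direction → Set
Turn x = ∃₂ λ a b → x ≡ a ∷ b ∷ []

∈-turns : ∀ {x} → x ∈ turns → Turn x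
∈-turns = All.lookup {P = Turn}
  (p All.∷ p All.∷ p All.∷ p All.∷ p All.∷ p All.∷ p All.∷ p All.∷ All.[])
  where
  p : ∀ {a b} → Turn (a ∷ b ∷ [])
  p = _ , _ , refl

-- The matching inside `Corresponds` forces `u` to have `n` letters. So members of `E π` have
-- `n + 1` letters in the strict case and `n + 2` in the quasi-strict case.
E-finite : ∀ {n} (π : Permutation′ n) → Finite (E π)
E-finite {n} π = words (2 + n) , λ {v} v∈E → ∈-words v (bounded v∈E)
  where
  bounded : ∀ {v} → E π v → length v ≤ 2 + n
  bounded (inj₁ (_ , strict q d ds , (_ , (_ , τ , _) , _) , refl)) = ≤-trans
    (≤-reflexive (trans (Φ-length q (d ∷ ds) (strict q d ds , refl)) (cong suc (↔⇒≡ τ))))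
    (n≤1+n _)
  bounded (inj₂ (_ , quasi-strict q r ds , (_ , (_ , τ , _) , _) , _ , _ , y , x∈turns , Φy , refl))
    with _ , _ , refl ← ∈-turns x∈turns =
    ≤-reflexive (cong (2 +_) (trans (Φ-length r ds Φy) (↔⇒≡ τ)))

Prefix⇒letter : ∀ {v y} → Prefix _≡_ v y →
  length v ≤ length y × (∀ {i} → i < length v → letter y i ≡ letter v i)
Prefix⇒letter []         = z≤n , λ ()
Prefix⇒letter {d ∷ v} {_ ∷ y} (refl ∷ p) = s≤s (proj₁ (Prefix⇒letter p)) , letters
  where
  letters : ∀ {i} → i < suc (length v) → letter (d ∷ y) i ≡ letter (d ∷ v) i
  letters {zero}  _         = refl
  letters {suc i} (s≤s i<v) = proj₂ (Prefix⇒letter p) i<v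

Factor⇒letter : ∀ {v y} → Factor v y →
  ∃[ a ] a + length v ≤ length y × (∀ {i} → i < length v → letter y (a + i) ≡ letter v i)
Factor⇒letter (here p)  = 0 , Prefix⇒letter p
Factor⇒letter (there f) with a , ≤y , eq ← Factor⇒letter f = suc a , s≤s ≤y , eq

E-factor⇒≼ : ∀ {m n} (π : Permutation′ m) (σ : Permutation′ n) {w} (s : Strict w) →
  Corresponds w σ → ∀ {v} → E π v → Factor v (φ s) → π ≼ σ
E-factor⇒≼ π σ (strict q d ds) (p , (_ , p≅σ) , o , _ , enc) = λ where
    (inj₁ (_ , strict q′ d′ ds′ , (p′ , (_ , p′≅π) , o′ , _ , enc′) , refl)) v∈y →
      strict-case q′ d′ ds′ p′ p′≅π o′ enc′ v∈y
    (inj₂ (_ , quasi-strict _ r ds′ , (p′ , (_ , p′≅π) , o′ , _ , enc′) ,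
      _ , _ , y′ , x∈turns , Φy′ , refl)) v∈y →
      quasi-case r ds′ p′ p′≅π o′ enc′ x∈turns Φy′ v∈y
  where
  y = φ (strict q d ds)
  N = length (dirs q (d ∷ ds))

  S : ℕ → Pin
  S = (o Vector.∷ p) ∘ clamp

  S-spiral : Spiral (letter y) S N
  S-spiral = Encodes⇒Spiral q (d ∷ ds) (o Vector.∷ p) enc (strict q d ds , refl)

  rigid : ∀ {q′ ds′ y′ T b} a → (Φy′ : Φ (dirs q′ ds′) y′) →
    Spiral (letter y′) T (length (dirs q′ ds′)) → b ≤ pred a →
    a + length y′ ≤ length y → (∀ {i} → i < length y′ → letter y (a + i) ≡ letter y′ i) →
    ∀ c i j → i ≤ length (dirs q′ ds′) → j ≤ length (dirs q′ ds′) →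
    SameOrder c (T i) (T j) (restart S b a i) (restart S b a j)
  rigid {q′} {ds′} {y′} a Φy′ t b≤a ≤y eq c i j = Spiral-rigid t
    (Spiral-cong (λ j≤ → eq (subst (_ <_) (sym (Φ-length q′ ds′ Φy′)) (s≤s j≤)))
      (Spiral-restart S-spiral b≤a (s≤s⁻¹ (subst₂ _≤_
        (trans (cong (a +_) (Φ-length q′ ds′ Φy′)) (+-suc a _))
        (Φ-length q (d ∷ ds) (strict q d ds , refl)) ≤y))))
    c

  strict-case : ∀ q′ d′ ds′ (p′ : Vector Pin (length (dirs q′ (d′ ∷ ds′)))) →
    OrderIsomorphic p′ π → ∀ o′ →
    (∀ i → Encodes (o′ Vector.∷ p′) i (lookup (dirs q′ (d′ ∷ ds′)) i)) →
    Factor (φ (strict q′ d′ ds′)) y → π ≼ σ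
  strict-case q′ d′ ds′ p′ p′≅π o′ enc′ v∈y with a , ≤y , eq ← Factor⇒letter v∈y =
    -- Entry `k` of `p` is pin `suc k` of `S`. The origin of `p′` is no point of `π`, so any early
    -- enough pin can replace it; `S 0` is taken.
    SameOrder⇒≼ {π = π} {σ} p′≅π p≅σ (λ i → clamp (a + toℕ i)) λ c i j →
      subst₂ (λ u v → SameOrder c u v (p (clamp (a + toℕ i))) (p (clamp (a + toℕ j))))
        (cong p′ (clamp-toℕ i)) (cong p′ (clamp-toℕ j))
        (rigid {ds′ = d′ ∷ ds′} a Φy′
          (Encodes⇒Spiral q′ (d′ ∷ ds′) (o′ Vector.∷ p′) enc′ Φy′) z≤n ≤y eq
          c (suc (toℕ i)) (suc (toℕ j)) (Fin.toℕ<n i) (Fin.toℕ<n j))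
    where Φy′ = strict q′ d′ ds′ , refl

  -- The first pin of `p′` becomes the origin of the others, and its image is pin `suc a` of `S`.
  -- The two letters of `x` move the restart to `2 + a`, so pin `suc a` is early enough and, its
  -- number being positive, a point of `σ`.
  quasi-case : ∀ {q′ x y′} r ds′ (p′ : Vector Pin (length (num q′ ∷ dirs r ds′))) →
    OrderIsomorphic p′ π → ∀ o′ →
    (∀ i → Encodes (o′ Vector.∷ p′) i (lookup (num q′ ∷ dirs r ds′) i)) →
    x ∈ turns → Φ (dirs r ds′) y′ → Factor (x ++ y′) y → π ≼ σ
  quasi-case r ds′ p′ p′≅π o′ enc′ x∈turns Φy′ v∈y
    with _ , _ , refl ← ∈-turns x∈turns
    with a , ≤y , eq ← Factor⇒letter v∈y =
    SameOrder⇒≼ {π = π} {σ} p′≅π p≅σ e λ c i j →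
      subst₂ (λ (u , u′) (v , v′) → SameOrder c u v u′ v′)
        (cong₂ _,_ (cong p′ (clamp-toℕ i)) (restart-e i))
        (cong₂ _,_ (cong p′ (clamp-toℕ j)) (restart-e j))
        (rigid (2 + a) Φy′
          (Encodes⇒Spiral r ds′ p′ (λ i → Encodes-tail (o′ Vector.∷ p′) i _ (enc′ (suc i))) Φy′)
          ≤-refl (subst (_≤ length y) (sym (shift _)) ≤y)
          (λ i<y′ → trans (cong (letter y) (shift _)) (eq (s≤s (s≤s i<y′))))
          c (toℕ i) (toℕ j) (s≤s⁻¹ (Fin.toℕ<n i)) (s≤s⁻¹ (Fin.toℕ<n j)))
    where
    shift : ∀ i → 2 + a + i ≡ a + (2 + i)
    shift i = trans (cong (_+ i) (+-comm 2 a)) (+-assoc a 2 i)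

    e : Fin (suc (length (dirs r ds′))) → Fin N
    e zero    = clamp a
    e (suc i) = clamp (2 + a + toℕ i)

    restart-e : ∀ i → restart S (suc a) (2 + a) (toℕ i) ≡ p (e i)
    restart-e zero    = refl
    restart-e (suc i) = refl

-- Intervals of simple permutations

last : {P : Pred ℕ 0ℓ} → Decidable P → ∀ t →
  (∃[ b ] b ≤ t × P b × (∀ {k} → b < k → k ≤ t → ¬ P k)) ⊎ (∀ {k} → k ≤ t → ¬ P k)
last {P} P? t with P? t
... | yes Pt = inj₁ (t , ≤-refl , Pt , λ t<k k≤t → contradiction t<k (≤⇒≯ k≤t))
last {P} P? zero    | no ¬P0 = inj₂ λ where z≤n → ¬P0
last {P} P? (suc t) | no ¬Pt with last P? t
... | inj₁ (b , b≤t , Pb , none) = inj₁ (b , m≤n⇒m≤1+n b≤t , Pb , λ b<k k≤ →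
  [ none b<k ∘ s≤s⁻¹ , (λ where refl → ¬Pt) ]′ (m≤n⇒m<n∨m≡n k≤))
... | inj₂ none = inj₂ λ k≤ → [ none ∘ s≤s⁻¹ , (λ where refl → ¬Pt) ]′ (m≤n⇒m<n∨m≡n k≤)

-- Used with the identity for positions and with `π` for values, so that one lemma turns both into
-- windows.
Convex : ∀ {m} → Permutation′ m → Pred (Fin m) 0ℓ → Set
Convex ρ A = ∀ {i j k} → A i → A k →
  (ρ ⟨$⟩ʳ i) Fin.< (ρ ⟨$⟩ʳ j) → (ρ ⟨$⟩ʳ j) Fin.< (ρ ⟨$⟩ʳ k) → A j

module _ {m : ℕ} (ρ : Permutation′ m) {A : Pred (Fin m) 0ℓ} (A? : Decidable A) (convex : Convex ρ A) where

  private
    value : Fin m → ℕ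
    value i = toℕ (ρ ⟨$⟩ʳ i)

    P : Pred ℕ 0ℓ
    P k = ∃[ i ] A i × value i ≡ k

    P? : Decidable P
    P? k = Fin.any? λ i → A? i ×-dec value i ≟ k

    P⇒A : ∀ {i} → P (value i) → A i
    P⇒A (j , Aj , j≡i) = subst A
      (trans (sym (inverseˡ ρ)) (trans (cong (ρ ⟨$⟩ˡ_) (Fin.toℕ-injective j≡i)) (inverseˡ ρ))) Aj

    P-convex : ∀ {i k l} → P i → P l → i < k → k < l → P k
    P-convex {k = k} (i , Ai , refl) (l , Al , refl) i<k k<l =
      ρ ⟨$⟩ˡ j , convex Ai Al (subst (value i <_) (sym j≡k) i<k) (subst (_< value l) (sym j≡k) k<l) ,
      j≡k
      where
      j = fromℕ< (<-trans k<l (Fin.toℕ<n _))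
      j≡k = trans (cong toℕ (inverseʳ ρ)) (Fin.toℕ-fromℕ< _)

    -- The start `a` is one past the last value up to `k` outside `P`, or 0. A member of `P` below
    -- that gap would fill it by convexity.
    least : ∀ {k} → P k → ∃[ a ] a ≤ k × (∀ {j} → a ≤ j → j ≤ k → P j) × (∀ {j} → P j → a ≤ j)
    least {k} Pk with last (¬? ∘ P?) k
    ... | inj₁ (b , b≤k , ¬Pb , all) = suc b , ≤∧≢⇒< b≤k (λ where refl → ¬Pb Pk) ,
      (λ b<j j≤k → decidable-stable (P? _) (all b<j j≤k)) , λ {j} Pj → ≰⇒> λ j≤b →
        ¬Pb (P-convex Pj Pk (≤∧≢⇒< j≤b (λ where refl → ¬Pb Pj)) (≤∧≢⇒< b≤k (λ where refl → ¬Pb Pk)))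
    ... | inj₂ all = 0 , z≤n , (λ _ j≤k → decidable-stable (P? _) (all j≤k)) , λ _ → z≤n

  Convex⇒Window : ∃ A → ∃₂ λ a b → b ≤ m × (∀ i → A i ⇔ Window a b (value i))
  Convex⇒Window (i , Ai) with a , a≤i , all , lower ← least (i , Ai , refl) | last P? m
  ... | inj₂ none = contradiction (i , Ai , refl) (none (<⇒≤ (Fin.toℕ<n _)))
  ... | inj₁ (t , _ , Pt@(i′ , _ , i′≡t) , none) =
    a , suc t , subst (_< m) i′≡t (Fin.toℕ<n _) , λ j → mk⇔
      (λ Aj → lower (j , Aj , refl) ,
        s≤s (≮⇒≥ λ t<j → none t<j (<⇒≤ (Fin.toℕ<n _)) (j , Aj , refl)))
      (λ (a≤j , j<t) → P⇒A (inside a≤j (s≤s⁻¹ j<t)))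
    where
    inside : ∀ {k} → a ≤ k → k ≤ t → P k
    inside {k} a≤k k≤t with k ≤? value i | m≤n⇒m<n∨m≡n k≤t
    ... | yes k≤i | _         = all a≤k k≤i
    ... | no _    | inj₂ refl = Pt
    ... | no k≰i  | inj₁ k<t  = P-convex (i , Ai , refl) Pt (≰⇒> k≰i) k<t

-- A missing `k` would leave a window of at least two but not all positions whose values also form a
-- window, against `Simple`.
Simple⇒no-interval : ∀ {m} {π : Permutation′ m} → Simple π →
  {A : Pred (Fin m) 0ℓ} → Decidable A → Convex Perm.id A → Convex π A →
  ∀ {i j k} → A i → A j → i ≢ j → A k
Simple⇒no-interval {m} {π} simple {A} A? position-convex value-convex {i} {j} {k} Ai Aj i≢j
  with A? k
... | yes Ak = Ak
... | no ¬Ak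
  with a , b , b≤m , positions ← Convex⇒Window Perm.id A? position-convex (i , Ai)
  with c , d , _ , values ← Convex⇒Window π A? value-convex (i , Ai)
  = ⊥-elim (simple a (b ∸ a) large small (subst (_≤ m) (sym a+l≡b) b≤m)
      (c , d , λ i → subst (λ e → Window a e (toℕ i) ⇔ Window c d (toℕ (π ⟨$⟩ʳ i))) (sym a+l≡b)
        (values i ⇔-∘ ⇔-sym (positions i))))
  where
  a+l≡b : a + (b ∸ a) ≡ b
  a+l≡b with a≤i , i<b ← to (positions i) Ai = m+[n∸m]≡n (≤-trans a≤i (<⇒≤ i<b))

  two : ∀ {x y} → A x → A y → x Fin.< y → 2 ≤ b ∸ a
  two Ax Ay x<y = subst (_≤ b ∸ a) (m+n∸n≡m 2 a)
    (∸-monoˡ-≤ a (≤-trans (s≤s (≤-trans (s≤s (proj₁ (to (positions _) Ax))) x<y))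
      (proj₂ (to (positions _) Ay))))

  large : 2 ≤ b ∸ a
  large with Fin.<-cmp i j
  ... | tri< i<j _ _ = two Ai Aj i<j
  ... | tri≈ _ i≡j _ = contradiction i≡j i≢j
  ... | tri> _ _ j<i = two Aj Ai j<i

  small : b ∸ a < m
  -- A window of length at least `m` that ends by `m` starts at 0 and so contains `k`.
  small = ≰⇒> λ m≤l → ¬Ak (from (positions k)
    ( subst (_≤ toℕ k) (sym (n≤0⇒n≡0 (+-cancelʳ-≤ m a 0
        (≤-trans (+-monoʳ-≤ a m≤l) (≤-trans (≤-reflexive a+l≡b) b≤m))))) z≤n
    , ≤-trans (Fin.toℕ<n k) (≤-trans m≤l (m∸n≤m b a))))

-- Occurrences of simple permutations

segment : (ℕ → Direction) → ℕ → ℕ → List Direction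
segment c s zero    = []
segment c s (suc l) = c s ∷ segment c (suc s) l

length-segment : ∀ c s l → length (segment c s l) ≡ l
length-segment c s zero    = refl
length-segment c s (suc l) = cong suc (length-segment c (suc s) l)

letter-segment : ∀ c s {l i} → i < l → letter (segment c s l) i ≡ c (s + i)
letter-segment c s {suc l} {zero}  _         = cong c (sym (+-identityʳ s))
letter-segment c s {suc l} {suc i} (s≤s i<l) =
  trans (letter-segment c (suc s) i<l) (cong c (sym (+-suc s i)))

segment-alternating : ∀ {c S N} → Spiral c S N → ∀ s l → s + l ≤ suc N → Alternating (segment c s l)
segment-alternating spiral s zero _ = []
segment-alternating spiral s (suc zero) _ = [-]
segment-alternating {N = N} spiral s (suc (suc l)) ≤N =
  spiral .bend (s≤s⁻¹ (≤-trans (s≤s (s≤s (m≤m+n s l))) ≤N′)) ∷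
  segment-alternating spiral (suc s) (suc l) (subst (_≤ suc N) (+-suc s (suc l)) ≤N)
  where
  ≤N′ : 2 + (s + l) ≤ suc N
  ≤N′ = subst (_≤ suc N) (trans (+-suc s (suc l)) (cong suc (+-suc s l))) ≤N

segment-tail : ∀ d y s l → segment (letter (d ∷ y)) (suc s) l ≡ segment (letter y) s l
segment-tail d y s zero    = refl
segment-tail d y s (suc l) = cong (letter y s ∷_) (segment-tail d y (suc s) l)

segment-Prefix : ∀ y l → l ≤ length y → Prefix _≡_ (segment (letter y) 0 l) y
segment-Prefix y       zero    _         = []
segment-Prefix (d ∷ y) (suc l) (s≤s l≤y) =
  refl ∷ subst (λ v → Prefix _≡_ v y) (sym (segment-tail d y 0 l)) (segment-Prefix y l l≤y)

segment-Factor : ∀ y s l → s + l ≤ length y → Factor (segment (letter y) s l) y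
segment-Factor y       zero    l l≤y       = here (segment-Prefix y l l≤y)
segment-Factor (d ∷ y) (suc s) l (s≤s ≤y) =
  there (subst (λ v → Factor v y) (sym (segment-tail d y s l)) (segment-Factor y s l ≤y))

-- The letters alternate, so the first three can be read back as a numeral and a direction. With `n`
-- zero there are just two, and they spell a single numeral.
segment-Φ : ∀ {c S N} → Spiral c S N → ∀ b n → b + suc n ≤ N →
  ∃[ q ] Quadrant q (c b) (c (suc b)) × Φ (dirs q (segment c (2 + b) n)) (segment c b (2 + n))
segment-Φ {c} s b zero ≤N =
  let q , ∈q = ⊥⇒Quadrant (c b) (c (suc b)) (s .bend (≤-trans (≤-reflexive (+-comm 1 b)) ≤N))
  in  q , ∈q , ∈q
segment-Φ {c} {N = N} s b (suc n) ≤N =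
  let q , ∈q , φ₂≡ = φ₂-surjective (c b) (c (suc b)) (c (2 + b)) (s .bend (<⇒≤ b<N)) (s .bend b<N)
  in  q , ∈q , strict q _ _ , sym (cong (_++ segment c (3 + b) n) φ₂≡)
  where
  b<N : 2 + b ≤ N
  b<N = ≤-trans (s≤s (s≤s (m≤m+n b n)))
    (≤-trans (≤-reflexive (sym (trans (+-suc b (suc n)) (cong suc (+-suc b n))))) ≤N)

module Subsequence {c : ℕ → Direction} {S : ℕ → Pin} {N : ℕ} (s : Spiral c S N)
  (h : ℕ → ℕ) (h-mono : ∀ {j k} → j < k → h j < h k)
  {n : ℕ} (h≤N : ∀ {k} → k ≤ n → h k ≤ N)
  (x : Vector Pin (suc n)) (x≗ : ∀ i → x i ≡ S (h (toℕ i))) where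

  h-mono-≤ : ∀ {j k} → j ≤ k → h j ≤ h k
  h-mono-≤ j≤k = [ (λ j<k → <⇒≤ (h-mono j<k)) , (λ where refl → ≤-refl) ]′ (m≤n⇒m<n∨m≡n j≤k)

  h-injective : ∀ {j k} → h j ≡ h k → j ≡ k
  h-injective {j} {k} hj≡hk with <-cmp j k
  ... | tri< j<k _ _ = contradiction hj≡hk (<⇒≢ (h-mono j<k))
  ... | tri≈ _ j≡k _ = j≡k
  ... | tri> _ _ k<j = contradiction (sym hj≡hk) (<⇒≢ (h-mono k<j))

  Beyond-before : ∀ {d J} i → h (toℕ i) ≡ J →
    (∀ {k} → k < toℕ i → Below d (S J) (S (h k))) → Beyond d (x i) (Before x i)
  Beyond-before {d} i refl below (k , k<i , refl) =
    subst₂ (Below d) (sym (x≗ i)) (sym (x≗ k)) (below k<i)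

  module _ (i : Fin n) {J : ℕ} (next : h (suc (toℕ i)) ≡ suc J) where

    J<N : J < N
    J<N = subst (_≤ N) next (h≤N (Fin.toℕ<n i))

    extreme : ∀ {k} → k < suc (toℕ i) → Below (c (suc J)) (S (suc J)) (S (h k))
    extreme k≤i = s .beyond (subst (h _ <_) next (h-mono k≤i)) J<N

    -- With pin `J` skipped, or with `J` the origin, the cutoff of `past` covers all earlier
    -- selected pins, so the new pin clears them along both axes.
    encodes-num : ∀ {q} → h (toℕ i) ≤ pred J → Quadrant q (c J) (c (suc J)) → Encodes x i (num q)
    encodes-num {q} hi≤ quadrant = InCorner⇒Independent q corner , corner
      where
      corner = from (InCorner⇔Beyond q quadrant)
        ( Beyond-before {c J} (suc i) next
            (λ k≤i → s .past (≤-trans (h-mono-≤ (s≤s⁻¹ k≤i)) hi≤) J<N)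
        , Beyond-before {c (suc J)} (suc i) next extreme)

    -- Along the axis of `c J`, `short` puts pin `J` on one side and `past` puts the selected pins
    -- before it on the other.
    encodes-dir : h (toℕ i) ≡ J → 0 < J → Encodes x i (dir (c (suc J)))
    encodes-dir hi≡J 0<J =
      Below⇒Separates (c J)
        (λ where refl → subst₂ (Below (c J)) (sym x-i) (sym x-next) (s .short 0<J J<N))
        (λ where (k , k<i , refl) → subst₂ (Below (c J)) (sym x-next) (sym (x≗ k))
                   (s .past (<⇒≤pred (subst (h _ <_) hi≡J
                     (h-mono (subst (toℕ k <_) (Fin.toℕ-inject₁ i) k<i)))) J<N)) ,
      Beyond-before {c (suc J)} (suc i) next extreme
      where
      x-i    = trans (x≗ (inject₁ i)) (cong S (trans (cong h (Fin.toℕ-inject₁ i)) hi≡J))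
      x-next = trans (x≗ (suc i)) (cong S next)

  distinct : ∀ a {i j} → i ≢ j → coord a (x i) ≢ coord a (x j)
  distinct a {i} {j} i≢j xi≡xj =
    Spiral-distinct s a (h≤N (s≤s⁻¹ (Fin.toℕ<n i))) (h≤N (s≤s⁻¹ (Fin.toℕ<n j)))
      (i≢j ∘ Fin.toℕ-injective ∘ h-injective)
      (trans (cong (coord a) (sym (x≗ i))) (trans xi≡xj (cong (coord a) (x≗ j))))

module Occurrence {y : List Direction} {S : ℕ → Pin} {N : ℕ}
  (s : Spiral (letter y) S N) (y-length : length y ≡ suc N)
  {m : ℕ} {π : Permutation′ m} {g : Fin m → ℕ} (drawn : Drawn (S ∘ g) π)
  (0<g : ∀ i → 0 < g i) (g≤N : ∀ i → g i ≤ N) where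

  c : ℕ → Direction
  c = letter y

  g-injective : ∀ {i j} → g i ≡ g j → i ≡ j
  g-injective {i} {j} gi≡gj with Fin.<-cmp i j
  ... | tri< i<j _ _ = contradiction (from (proj₁ (drawn i j)) i<j)
                         (ℤ.<-irrefl (cong (col ∘ S) gi≡gj))
  ... | tri≈ _ i≡j _ = i≡j
  ... | tri> _ _ j<i = contradiction (from (proj₁ (drawn j i)) j<i)
                         (ℤ.<-irrefl (cong (col ∘ S) (sym gi≡gj)))

  -- Built with `Vector.∷` so that putting `S 0` back in front of the tail gives `pins h` again by
  -- definition, as `corresponds` requires.
  pins : (ℕ → ℕ) → ∀ {n} → Vector Pin (suc n)
  pins h = S 0 Vector.∷ λ i → S (h (suc (toℕ i)))

  pins≗ : ∀ h → h 0 ≡ 0 → ∀ {n} (i : Fin (suc n)) → pins h i ≡ S (h (toℕ i))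
  pins≗ h h0≡0 zero    = cong S (sym h0≡0)
  pins≗ h h0≡0 (suc i) = refl

  Used : Pred ℕ 0ℓ
  Used k = ∃[ i ] g i ≡ k

  Used? : Decidable Used
  Used? k = Fin.any? λ i → g i ≟ k

  module _ (w : Word) (h : ℕ → ℕ) (h0≡0 : h 0 ≡ 0) (h-mono : ∀ {j k} → j < k → h j < h k)
    (used : ∀ {k} → k < length w → Used (h (suc k)))
    (all-used : ∀ i → ∃[ k ] k < length w × h (suc k) ≡ g i) where

    private
      h≤N : ∀ {k} → k ≤ length w → h k ≤ N
      h≤N {zero}  _   = subst (_≤ N) (sym h0≡0) z≤n
      h≤N {suc k} k<w = let i , gi≡ = used k<w in subst (_≤ N) gi≡ (g≤N i)

    open Subsequence s h h-mono h≤N (pins h {length w}) (pins≗ h h0≡0) public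

    corresponds : (∀ i → Encodes (pins h) i (lookup w i)) → Corresponds w π
    corresponds enc =
      Vector.tail (pins h) ,
      (Encodes⇒PinSequence-tail (pins h) enc distinct ,
       Drawn⇒OrderIsomorphic {π = π} drawn (proj₁ ρ) (λ i → cong S (proj₂ ρ i))) ,
      S 0 , Encodes⇒PinSequence (pins h) enc distinct , enc
      where
      ρ : Σ[ ρ ∈ Permutation (length w) m ] ∀ i → g (ρ ⟨$⟩ʳ i) ≡ h (suc (toℕ i))
      ρ = enumeration (λ i → h (suc (toℕ i))) g
        (Fin.toℕ-injective ∘ suc-injective ∘ h-injective) g-injective
        (λ i → used (Fin.toℕ<n i))
        (λ j → let k , k<w , hk≡ = all-used j
               in  fromℕ< k<w , trans (cong (h ∘ suc) (Fin.toℕ-fromℕ< k<w)) hk≡)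

  module _ (b n : ℕ) (run : ∀ {k} → b < k → k ≤ b + suc n → Used k) where

    private
      ds : List Direction
      -- Pin `suc b` uses up letters `b` and `suc b` for its numeral.
      ds = segment c (2 + b) n

      length-ds : ∀ q → length (dirs q ds) ≡ suc n
      length-ds q = cong suc (trans (List.length-map dir ds) (length-segment c (2 + b) n))

      run-used : ∀ q {k} → k < length (dirs q ds) → Used (suc (b + k))
      run-used q {k} k<w = run (s≤s (m≤m+n b k))
        (subst (_≤ b + suc n) (+-suc b k) (+-monoʳ-≤ b (subst (suc k ≤_) (length-ds q) k<w)))

      run-index : ∀ q {k} → b < k → k ≤ b + suc n →
        ∃[ j ] j < length (dirs q ds) × suc (b + j) ≡ k
      run-index q {k} b<k k≤t = k ∸ suc b ,
        subst (k ∸ suc b <_) (sym (length-ds q))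
          (+-cancelˡ-≤ b _ _ (≤-trans (≤-reflexive (trans (+-suc b _) (m+[n∸m]≡n b<k))) k≤t)) ,
        m+[n∸m]≡n b<k

      lookup-ds : ∀ q (i : Fin (length (map dir ds))) →
        lookup (dirs q ds) (suc i) ≡ dir (c (2 + b + toℕ i))
      lookup-ds q i = trans (lookup-dir ds i)
        (cong dir (letter-segment c (2 + b) (subst (toℕ i <_)
          (trans (List.length-map dir ds) (length-segment c (2 + b) n)) (Fin.toℕ<n i))))

    run-bound : b + suc n ≤ N
    run-bound = let i , gi≡ = run (m<m+n b z<s) ≤-refl in subst (_≤ N) gi≡ (g≤N i)

    strict-corresponds : (∀ i → b < g i × g i ≤ b + suc n) →
      ∀ {q} → Quadrant q (c b) (c (suc b)) → Corresponds (dirs q ds) π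
    strict-corresponds in-run {q} quadrant = corresponds′ λ where
        zero    → num-letter zero (cong suc (+-identityʳ b)) z≤n quadrant
        (suc i) → subst (Encodes (pins h) (suc i)) (sym (lookup-ds q i))
          (dir-letter (suc i) (cong suc (+-suc b (toℕ i))) refl z<s)
      where
      h : ℕ → ℕ
      h zero    = 0
      h (suc j) = suc (b + j)

      h-mono : ∀ {j k} → j < k → h j < h k
      h-mono {zero}  {suc k} _         = z<s
      h-mono {suc j} {suc k} (s≤s j<k) = s≤s (+-monoʳ-< b j<k)

      all-used : ∀ i → ∃[ k ] k < length (dirs q ds) × h (suc k) ≡ g i
      all-used i = let b<g , g≤t = in-run i in run-index q b<g g≤t

      corresponds′ = corresponds (dirs q ds) h refl h-mono (run-used q) all-used
      num-letter   = encodes-num (dirs q ds) h refl h-mono (run-used q) all-used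
      dir-letter   = encodes-dir (dirs q ds) h refl h-mono (run-used q) all-used

    -- The first numeral `r` is the corner of pin `g i₀` as seen from `S 0`. The second letter is a
    -- numeral because number `b` lies between `g i₀` and `suc b` and is skipped.
    quasi-corresponds : ∀ i₀ → g i₀ < b → (∀ i → i₀ ≢ i → b < g i × g i ≤ b + suc n) →
      ∀ {q} → Quadrant q (c b) (c (suc b)) → ∃[ r ] Corresponds (num r ∷ dirs q ds) π
    quasi-corresponds i₀ g₀<b in-run {q} quadrant = r , corresponds′ λ where
        zero          → num-letter zero (sym g₀≡) z≤n r-quadrant
        (suc zero)    → num-letter (suc zero) (cong suc (+-identityʳ b)) (<⇒≤pred g₀<b) quadrant
        (suc (suc i)) → subst (Encodes (pins h) (suc (suc i))) (sym (lookup-ds q i))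
          (dir-letter (suc (suc i)) (cong suc (+-suc b (toℕ i))) refl z<s)
      where
      g₀≡ : suc (pred (g i₀)) ≡ g i₀
      g₀≡ = suc-pred (g i₀) ⦃ >-nonZero (0<g i₀) ⦄

      first-quadrant : ∃[ r ] Quadrant r (c (pred (g i₀))) (c (suc (pred (g i₀))))
      first-quadrant = ⊥⇒Quadrant _ _ (s .bend (subst (_≤ N) (sym g₀≡) (g≤N i₀)))

      r = proj₁ first-quadrant
      r-quadrant = proj₂ first-quadrant

      h : ℕ → ℕ
      h zero          = 0
      h (suc zero)    = g i₀
      h (suc (suc j)) = suc (b + j)

      h-mono : ∀ {j k} → j < k → h j < h k
      h-mono {zero}        {suc zero}    _               = 0<g i₀
      h-mono {zero}        {suc (suc k)} _               = z<s
      h-mono {suc zero}    {suc (suc k)} _               = s≤s (≤-trans (<⇒≤ g₀<b) (m≤m+n b k))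
      h-mono {suc zero}    {suc zero}    (s≤s ())
      h-mono {suc (suc j)} {suc zero}    (s≤s ())
      h-mono {suc (suc j)} {suc (suc k)} (s≤s (s≤s j<k)) = s≤s (+-monoʳ-< b j<k)

      used : ∀ {k} → k < length (num r ∷ dirs q ds) → Used (h (suc k))
      used {zero}  _         = i₀ , refl
      used {suc k} (s≤s k<w) = run-used q k<w

      all-used : ∀ i → ∃[ k ] k < length (num r ∷ dirs q ds) × h (suc k) ≡ g i
      all-used i with i₀ Fin.≟ i
      ... | yes refl = 0 , z<s , refl
      ... | no i₀≢i with b<g , g≤t ← in-run i i₀≢i with k , k<w , ≡g ← run-index q b<g g≤t =
        suc k , s≤s k<w , ≡g

      corresponds′ = corresponds (num r ∷ dirs q ds) h refl h-mono used all-used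
      num-letter   = encodes-num (num r ∷ dirs q ds) h refl h-mono used all-used
      dir-letter   = encodes-dir (num r ∷ dirs q ds) h refl h-mono used all-used

    segment-bound : ∀ a e → a + e ≡ b → a + (e + (2 + n)) ≤ length y
    segment-bound a e a+e≡b = subst₂ _≤_
      (trans (sym (+-suc b (suc n))) (trans (cong (_+ (2 + n)) (sym a+e≡b)) (+-assoc a e (2 + n))))
      (sym y-length) (s≤s run-bound)

    strict-occurrence : 0 < n → (∀ i → b < g i × g i ≤ b + suc n) →
      ∃[ v ] E π v × Factor v y
    strict-occurrence 0<n in-run =
      let q , quadrant , Φv = segment-Φ s b n run-bound
      in  segment c b (2 + n) , inj₁ (E-strict n 0<n Φv (strict-corresponds in-run quadrant)) ,
          segment-Factor y b (2 + n) (segment-bound b 0 (+-identityʳ b))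
      where
      -- Matching on `n` exposes the first direction, which a strict word must have.
      E-strict : ∀ {q v} n → 0 < n → Φ (dirs q (segment c (2 + b) n)) v →
        Corresponds (dirs q (segment c (2 + b) n)) π → ∃[ u ] Σ[ s ∈ Strict u ] Corresponds u π × v ≡ φ s
      E-strict (suc n) _ (st , v≡) corr = _ , st , corr , v≡

  -- A used pin with a positive number lies before `b`, so `b` is at least 2, and the letters
  -- `b - 2` and `b - 1` exist to form the turn.
  quasi-occurrence : ∀ b n → (∀ {k} → b < k → k ≤ b + suc n → Used k) →
    ∀ i₀ → g i₀ < b → (∀ i → i₀ ≢ i → b < g i × g i ≤ b + suc n) →
    ∃[ v ] E π v × Factor v y
  quasi-occurrence b@(suc zero) n run i₀ g₀<b in-run =
    contradiction (0<g i₀) (≤⇒≯ (s≤s⁻¹ g₀<b))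
  quasi-occurrence b@(suc (suc a)) n run i₀ g₀<b in-run =
    let q , quadrant , Φv = segment-Φ s b n (run-bound b n run)
        r , corr = quasi-corresponds b n run i₀ g₀<b in-run quadrant
    in  segment c a (4 + n) ,
        inj₂ (num r ∷ dirs q (segment c (2 + b) n) , quasi-strict r q _ , corr ,
          (s≤s (s≤s (s≤s z≤n)) ,
           segment-alternating s a (4 + n) (subst (a + (4 + n) ≤_) y-length bound)) ,
          c a ∷ c (suc a) ∷ [] , segment c b (2 + n) , ⊥⇒turn _ _ (s .bend a<N) , Φv , refl) ,
        segment-Factor y a (4 + n) bound
    where
    bound : a + (4 + n) ≤ length y
    bound = segment-bound b n run a 2 (+-comm a 2)

    a<N : a < N
    a<N = ≤-trans (<⇒≤ (s≤s (s≤s (m≤m+n a (suc n))))) (run-bound b n run)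

  -- Pin `j` comes after number `b`, so its predecessor is not among the pins before `b`, and
  -- `outside` applies.
  no-between : ∀ a {b i j k} → i < b → k < b → b < j → j ≤ N →
    coord a (S i) ℤ.< coord a (S j) → ¬ coord a (S j) ℤ.< coord a (S k)
  no-between a {j = suc j} i<b k<b b≤j j≤N with d , refl , below ← outside s j≤N a =
    Below⇒not-between d (below (earlier i<b)) (below (earlier k<b))
    where
    earlier : ∀ {i} → i < _ → i ≤ pred j
    earlier i<b = <⇒≤pred (≤-trans i<b (s≤s⁻¹ b≤j))

  unused-split : ∀ {b} → ¬ Used b → ∀ i → ¬ g i < b → b < g i
  unused-split ¬b i gi≮b = ≤∧≢⇒< (≮⇒≥ gi≮b) (λ b≡gi → ¬b (i , sym b≡gi))

  -- The pins used before an unused number form an interval of π.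
  before-unused-trivial : Simple π → ∀ {b} → ¬ Used b →
    ∀ {i j k} → g i < b → g j < b → i ≢ j → g k < b
  before-unused-trivial simple {b} ¬b =
    Simple⇒no-interval {π = π} simple (λ i → g i <? b)
      (λ Ai Ak i<j j<k → convex horizontal Ai Ak
        (from (proj₁ (drawn _ _)) i<j) (from (proj₁ (drawn _ _)) j<k))
      (λ Ai Ak i<j j<k → convex vertical Ai Ak
        (from (proj₂ (drawn _ _)) i<j) (from (proj₂ (drawn _ _)) j<k))
    where
    convex : ∀ a {i j k} → g i < b → g k < b →
      coord a (S (g i)) ℤ.< coord a (S (g j)) → coord a (S (g j)) ℤ.< coord a (S (g k)) → g j < b
    convex a {j = j} gi<b gk<b i<j j<k = decidable-stable (g j <? b) λ gj≮b →
      no-between a gi<b gk<b (unused-split ¬b j gj≮b) (g≤N j) i<j j<k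

  occurrence : Simple π → 2 ≤ m → ∃[ v ] E π v × Factor v y
  occurrence simple 2≤m with last Used? N
  ... | inj₂ none = contradiction (fromℕ< (<⇒≤ 2≤m) , refl) (none (g≤N _))
  ... | inj₁ (t , t≤N , (top , g-top≡t) , above) with last (¬? ∘ Used?) t
  ... | inj₂ all = contradiction (λ (i , gi≡0) → <⇒≢ (0<g i) (sym gi≡0)) (all z≤n)
  ... | inj₁ (b , b≤t , ¬b , run) = conclude (m≤n⇒∃[o]m+o≡n b<t)
    where
    b<t : b < t
    b<t = ≤∧≢⇒< b≤t (λ where refl → ¬b (top , g-top≡t))

    g≤t : ∀ i → g i ≤ t
    g≤t i = ≮⇒≥ λ t<gi → above t<gi (g≤N i) (i , refl)

    top≮b : ¬ g top < b
    top≮b g<b = <-asym b<t (subst (_< b) g-top≡t g<b)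

    used : ∀ {n} → suc b + n ≡ t → ∀ {k} → b < k → k ≤ b + suc n → Used k
    used {n} b+n≡t b<k k≤t =
      decidable-stable (Used? _) (run b<k (subst (_ ≤_) (trans (+-suc b n) b+n≡t) k≤t))

    bounded : ∀ {n} → suc b + n ≡ t → ∀ i → g i ≤ b + suc n
    bounded {n} b+n≡t i = subst (g i ≤_) (sym (trans (+-suc b n) b+n≡t)) (g≤t i)

    -- Otherwise pin `suc b` would be the only one used, although `π` has at least two points.
    not-alone : ∀ {n} → suc b + n ≡ t → (∀ i → b < g i) → 0 < n
    not-alone {suc _} _     _   = z<s
    not-alone {zero}  b+0≡t b<g = contradiction
      (trans (sym (Fin.toℕ-fromℕ< (<⇒≤ 2≤m))) (trans (cong toℕ i≡j) (Fin.toℕ-fromℕ< 2≤m))) λ ()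
      where
      only : ∀ i → g i ≡ suc b
      only i = ≤-antisym (subst (g i ≤_) (trans (sym b+0≡t) (cong suc (+-identityʳ b))) (g≤t i)) (b<g i)

      i≡j : fromℕ< (<⇒≤ 2≤m) ≡ fromℕ< 2≤m
      i≡j = g-injective (trans (only _) (sym (only _)))

    conclude : ∃[ n ] suc b + n ≡ t → ∃[ v ] E π v × Factor v y
    conclude (n , b+n≡t) with Fin.any? (λ i → g i <? b)
    ... | no none = strict-occurrence b n (used b+n≡t)
      (not-alone b+n≡t (λ i → unused-split ¬b i λ gi<b → none (i , gi<b)))
      (λ i → unused-split ¬b i (λ gi<b → none (i , gi<b)) , bounded b+n≡t i)
    ... | yes (i , gi<b) = quasi-occurrence b n (used b+n≡t) i gi<b λ j i≢j →
      -- A second used pin before `b` would force all used pins before `b`, but `top` comes after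
      -- it.
      unused-split ¬b j (λ gj<b → top≮b (before-unused-trivial simple ¬b gi<b gj<b i≢j)) ,
      bounded b+n≡t j

≼⇒E-factor : ∀ {m n} (π : Permutation′ m) (σ : Permutation′ n) {w} → 2 ≤ m → Simple π →
  (s : Strict w) → Corresponds w σ → π ≼ σ → ∃[ v ] E π v × Factor v (φ s)
≼⇒E-factor π σ 2≤m simple (strict q d ds) (p , (_ , p≅σ) , o , _ , enc) π≼σ =
  let g , drawn = ≼⇒Drawn {π = π} {σ} p≅σ π≼σ
  in  Occurrence.occurrence
        (Encodes⇒Spiral q (d ∷ ds) (o Vector.∷ p) enc Φy) (Φ-length q (d ∷ ds) Φy)
        -- The shift by one leaves number 0 to the origin.
        {π = π} {g = suc ∘ toℕ ∘ g}
        (λ i j → subst₂ (λ u v → (col u ℤ.< col v ⇔ i Fin.< j) ×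
                                 (row u ℤ.< row v ⇔ (π ⟨$⟩ʳ i) Fin.< (π ⟨$⟩ʳ j)))
          (cong p (sym (clamp-toℕ (g i)))) (cong p (sym (clamp-toℕ (g j)))) (drawn i j))
        (λ _ → z<s) (λ i → Fin.toℕ<n (g i)) simple 2≤m
  where Φy = strict q d ds , refl

theorem2 : ∀ {m n} (π : Permutation′ m) (σ : Permutation′ n) {w : Word} →
    2 ≤ m → Simple π → (s : Strict w) → Corresponds w σ →
    Finite (E π) × ((¬ (π ≼ σ)) ⇔ (¬ (∃[ v ] E π v × Factor v (φ s))))
theorem2 π σ 2≤m simple s w↦σ = E-finite π , mk⇔
  (λ π⋠σ (_ , v∈E , v∈φ) → π⋠σ (E-factor⇒≼ π σ s w↦σ v∈E v∈φ))
  (λ avoids π≼σ → avoids (≼⇒E-factor π σ 2≤m simple s w↦σ π≼σ))
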